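{- Let $\mathcal{O}$ be an order of an algebraic number field and let $n\ge 2$ be an integer. Then every matrix in $M_n(\mathcal{O})$ is a sum of sixth powers of matrices in $M_n(\mathcal{O})$ if and only if $\gcd(6,\operatorname{disc}\mathcal{O})=1$.
   Context: An order of an algebraic number field $K$ of degree $m$ is a subring of $K$ containing $1$ which is a free $\mathbb{Z}$-module of rank $m$. $\operatorname{disc}\mathcal{O}$ is the discriminant of $\mathcal{O}$. A matrix $M$ is a sum of sixth powers in $M_n(\mathcal{O})$ if $M=\sum_{i=1}^r M_i^6$ for some $r\ge1$ and $M_i\in M_n(\mathcal{O})$. -}

module Defs where

open import Data.Nat as ℕ using (ℕ; zero; suc)
open import Data.Integer as ℤ using (ℤ; +_; 0ℤ; 1ℤ; -_)
open import Data.Fin using (Fin; zero; suc; punchIn; _≟_)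
open import Relation.Nullary using (yes; no)
open import Data.Sum using (_⊎_)
open import Data.Product using (Σ; ∃; _,_)
open import Relation.Binary.PropositionalEquality using (_≡_)

Σℤ : ∀ {k} → (Fin k → ℤ) → ℤ
Σℤ {zero}  f = 0ℤ
Σℤ {suc k} f = f zero ℤ.+ Σℤ (λ i → f (suc i))

-- Elements of a rank-m free ℤ-module, written in a fixed ℤ-basis e₀..e_{m-1}

Elt : ℕ → Set
Elt m = Fin m → ℤ

_≈_ : ∀ {m} → Elt m → Elt m → Set
x ≈ y = ∀ k → x k ≡ y k

0E : ∀ {m} → Elt m
0E _ = 0ℤ

_+E_ : ∀ {m} → Elt m → Elt m → Elt m
(x +E y) k = x k ℤ.+ y k

basis : ∀ {m} → Fin m → Elt m
basis i j with i ≟ j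
... | yes _ = 1ℤ
... | no _  = 0ℤ

-- ℤ-bilinear multiplication determined by structure constants
-- e_i * e_j = Σ_k c i j k e_k
mulSC : ∀ {m} → (Fin m → Fin m → Fin m → ℤ) → Elt m → Elt m → Elt m
mulSC c x y k = Σℤ (λ i → Σℤ (λ j → x i ℤ.* (y j ℤ.* c i j k)))

-- An order of an algebraic number field of degree m:
-- a commutative unital ring structure on ℤ^m (so a free ℤ-module of
-- rank m) with ℤ-bilinear multiplication and no zero divisors.
-- (Then K = O ⊗ ℚ is a finite-dimensional ℚ-domain, hence a number
-- field of degree m, and O is a subring of K containing 1 which is free
-- of rank m; conversely every order arises this way.)

record Order : Set where
  field
    deg      : ℕ
    deg≥1    : 1 ℕ.≤ deg
    sc       : Fin deg → Fin deg → Fin deg → ℤ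
    one      : Elt deg
  _·_ : Elt deg → Elt deg → Elt deg
  _·_ = mulSC sc
  field
    ·-comm   : ∀ x y → (x · y) ≈ (y · x)
    ·-assoc  : ∀ x y z → ((x · y) · z) ≈ (x · (y · z))
    ·-identityˡ : ∀ x → (one · x) ≈ x
    noZeroDivisors : ∀ x y → (x · y) ≈ 0E → (x ≈ 0E) ⊎ (y ≈ 0E)

det : ∀ {k} → (Fin k → Fin k → ℤ) → ℤ
det {zero}  A = 1ℤ
det {suc k} A = Σℤ (λ j → sign j ℤ.* (A zero j ℤ.* det (λ r c → A (suc r) (punchIn j c))))
  where
  sign : ∀ {l} → Fin l → ℤ
  sign zero = 1ℤ
  sign (suc j) = - sign j

module _ (O : Order) where
  open Order O

  trace : Elt deg → ℤ
  trace x = Σℤ (λ k → (x · basis k) k)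

  disc : ℤ
  disc = det (λ i j → trace (basis i · basis j))

  Mat : ℕ → Set
  Mat n = Fin n → Fin n → Elt deg

  _≈M_ : ∀ {n} → Mat n → Mat n → Set
  A ≈M B = ∀ i j → A i j ≈ B i j

  ΣE : ∀ {k} → (Fin k → Elt deg) → Elt deg
  ΣE {zero}  f = 0E
  ΣE {suc k} f = f zero +E ΣE (λ i → f (suc i))

  _*M_ : ∀ {n} → Mat n → Mat n → Mat n
  (A *M B) i j = ΣE (λ l → A i l · B l j)

  _+M_ : ∀ {n} → Mat n → Mat n → Mat n
  (A +M B) i j = A i j +E B i j

  sixth : ∀ {n} → Mat n → Mat n
  sixth A = A *M (A *M (A *M (A *M (A *M A))))

  sumSixth : ∀ {n r} → (Fin (suc r) → Mat n) → Mat n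
  sumSixth {r = zero}  Ms = sixth (Ms zero)
  sumSixth {r = suc r} Ms = sixth (Ms zero) +M sumSixth (λ i → Ms (suc i))

  IsSumOfSixthPowers : ∀ {n} → Mat n → Set
  IsSumOfSixthPowers {n} M = Σ ℕ (λ r → Σ (Fin (suc r) → Mat n) (λ Ms → M ≈M sumSixth Ms))

{-# OPTIONS --safe #-}

-- Write p for 2 or 3. A sixth power is a p-th power, and tr (Aᵖ) ≡ (tr A)ᵖ modulo p, so if all matrices are sums of
-- sixth powers, then every element of 𝒪 is a p-th power modulo p. By finiteness every x in 𝒪/p then satisfies x^q = x
-- for some power q > 1 of p, whence (ad x)^q = ad x on the endomorphisms of 𝒪/p, and f ↦ f - (ad x)^(q-1) f projects
-- onto the centraliser of x without changing the traces of f y for y in 𝒪. Doing this for a basis turns z ↦ φ(z) 1 into a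
-- multiplication by some u with φ = tr (u -), for any functional φ; so the trace form is invertible modulo p.
-- Conversely, let the discriminant be prime to p. If xᵖ = 0 in 𝒪/p then tr (x y)ᵖ = tr (xᵖ yᵖ) = 0 for all y, so x = 0;
-- the Frobenius map of the finite ring 𝒪/p is injective, hence surjective. Thus every x is y² + 2w and also z³ + 3v.
-- Among 2 × 2 matrices, idempotents and -I (the sixth power of [[0, -1], [1, 0]]) generate everything of trace zero,
-- [[0, e], [1, 0]] and [[1, e], [1, 0]] contribute the traces 2e³ and 1 + 6e + 9e² + 2e³, and these suffice. Conjugating
-- into two coordinates handles n × n matrices.
module Submission where

open import Algebra.Bundles using (CommutativeRing; Ring)
import Algebra.Construct.Pointwise as Pointwise
import Algebra.Properties.Ring
import Algebra.Properties.Semiring.Mult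
import Algebra.Properties.Semiring.Sum
import Algebra.Solver.CommutativeMonoid
import Algebra.Solver.Ring
open import Algebra.Solver.Ring.AlmostCommutativeRing using (fromCommutativeRing; _-Raw-AlmostCommutative⟶_)
open import Data.Empty using (⊥-elim)
open import Data.Fin.Base using (Fin; zero; suc; punchIn; toℕ; fromℕ<; funToFin; finToFun)
import Data.Fin.Properties as Finₚ
open import Data.Fin.Properties using (suc-injective; punchInᵢ≢i)
open import Data.Integer.Base as ℤ using (ℤ; +_; -[1+_]; +[1+_])
import Data.Integer.Divisibility.Signed as Signed
open import Data.Integer.DivMod using (_/ℕ_; a≡a%ℕn+[a/ℕn]*n; n%ℕd<d)
open import Data.Integer.GCD using (gcd)
import Data.Integer.Properties as ℤₚ
open import Data.Maybe.Base using (Maybe; just; nothing)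
open import Data.Nat.Base as ℕ using (ℕ; zero; suc; _≤_; s≤s; z≤n)
import Data.Nat.Divisibility as ℕ
import Data.Nat.GCD as ℕ
import Data.Nat.Properties as ℕₚ
open import Data.Product.Base using (∃-syntax; _×_; _,_; proj₁; proj₂)
open import Data.Sum.Base as Sum using (_⊎_; inj₁; inj₂)
open import Data.Vec.Functional using (_∷_; foldr; insertAt; updateAt)
open import Data.Vec.Functional.Properties using (insertAt-lookup; insertAt-punchIn; updateAt-updates; updateAt-minimal)
open import Defs using (Order; Elt; Mat; disc; IsSumOfSixthPowers; sumSixth; Σℤ; ΣE; basis; mulSC; _*M_)
import Defs
open import Function.Base using (_∘_; const; _$_)
open import Function.Bundles using (_⇔_; mk⇔)
import Level
import Relation.Binary.PropositionalEquality as ≡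
open ≡ using (_≡_; _≢_)
import Relation.Binary.Reasoning.Setoid
open import Relation.Binary.Structures using (IsEquivalence)
open import Relation.Nullary using (yes; no; ¬_)
open import Relation.Nullary.Decidable using (from-yes; from-no)

-- The two matrices come from the power sum λ⁶ + μ⁶ = s⁶ - 6s⁴q + 9s²q² - 2q³ of the eigenvalues of
-- a 2 × 2 matrix with trace s and determinant q: they realise s = 0 and s = 1 with q = -e. Modulo 2
-- this polynomial is (s³ + sq)² and modulo 3 it is (s² + q)³, which is the trace obstruction in
-- size 2. Sums of sixth powers are closed under addition but not visibly under negation. The traces
-- reached are therefore first shown to contain all of 12𝒪; from then on they form a group. A
-- textbook proof about the discriminant would decompose 𝒪/p into fields. Projecting onto
-- centralisers replaces this by linear algebra over ℤ/p. Determinants enter in two ways: Cramer's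
-- rule turns an invertible discriminant into nondegeneracy of the trace form, and multiplicativity
-- turns a dual basis into an invertible discriminant.

-- Ring solver with integer coefficients over any commutative ring

module IntegerCoefficients {c ℓ} (R : CommutativeRing c ℓ) where
  open CommutativeRing R
  open Algebra.Properties.Semiring.Mult semiring using (×-homo-+; ×1-homo-*) renaming (_×_ to _×1_)
  open Algebra.Properties.Ring ring
  open Relation.Binary.Reasoning.Setoid setoid

  -- Unlike n ×1 1#, the value at 1 is 1# on the nose, so that con (+ 1) stands for 1# in goals.
  ⟦_⟧ℕ : ℕ → Carrier
  ⟦ zero ⟧ℕ        = 0#
  ⟦ suc zero ⟧ℕ    = 1#
  ⟦ suc (suc n) ⟧ℕ = 1# + ⟦ suc n ⟧ℕ

  ⟦_⟧ℤ : ℤ → Carrier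
  ⟦ + n ⟧ℤ      = ⟦ n ⟧ℕ
  ⟦ -[1+ n ] ⟧ℤ = - ⟦ suc n ⟧ℕ

  ⟦⟧ℕ-× : ∀ n → ⟦ n ⟧ℕ ≈ n ×1 1#
  ⟦⟧ℕ-× zero          = refl
  ⟦⟧ℕ-× (suc zero)    = sym (+-identityʳ 1#)
  ⟦⟧ℕ-× (suc (suc n)) = +-congˡ (⟦⟧ℕ-× (suc n))

  ⟦⟧ℕ-+ : ∀ m n → ⟦ m ℕ.+ n ⟧ℕ ≈ ⟦ m ⟧ℕ + ⟦ n ⟧ℕ
  ⟦⟧ℕ-+ m n = trans (⟦⟧ℕ-× (m ℕ.+ n))
    (trans (×-homo-+ 1# m n) (+-cong (sym (⟦⟧ℕ-× m)) (sym (⟦⟧ℕ-× n))))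

  ⟦⟧ℕ-* : ∀ m n → ⟦ m ℕ.* n ⟧ℕ ≈ ⟦ m ⟧ℕ * ⟦ n ⟧ℕ
  ⟦⟧ℕ-* m n = trans (⟦⟧ℕ-× (m ℕ.* n))
    (trans (×1-homo-* m n) (*-cong (sym (⟦⟧ℕ-× m)) (sym (⟦⟧ℕ-× n))))

  ⟦⟧-neg : ∀ i → ⟦ ℤ.- i ⟧ℤ ≈ - ⟦ i ⟧ℤ
  ⟦⟧-neg (+ zero)  = sym -0#≈0#
  ⟦⟧-neg (+[1+ n ]) = refl
  ⟦⟧-neg -[1+ n ]  = sym (-‿involutive _)

  shift : ∀ a x y → x - y ≈ (a + x) - (a + y)
  shift a x y = begin
    x - y                  ≈⟨ +-congʳ (+-identityˡ x) ⟨
    (0# + x) - y           ≈⟨ +-congʳ (+-congʳ (-‿inverseʳ a)) ⟨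
    ((a - a) + x) - y      ≈⟨ +-congʳ (trans (+-assoc a (- a) x) (trans (+-congˡ (+-comm _ x)) (sym (+-assoc a x _)))) ⟩
    ((a + x) - a) - y      ≈⟨ +-assoc (a + x) (- a) (- y) ⟩
    (a + x) + (- a - y)    ≈⟨ +-congˡ (-‿+-comm a y) ⟩
    (a + x) - (a + y)      ∎

  ⟦⟧-⊖ : ∀ m n → ⟦ m ℤ.⊖ n ⟧ℤ ≈ ⟦ m ⟧ℕ - ⟦ n ⟧ℕ
  ⟦⟧-⊖ zero    zero    = sym (trans (+-identityˡ _) -0#≈0#)
  ⟦⟧-⊖ zero    (suc n) = sym (+-identityˡ _)
  ⟦⟧-⊖ (suc m) zero    = sym (trans (+-congˡ -0#≈0#) (+-identityʳ _))
  ⟦⟧-⊖ (suc m) (suc n) = begin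
    ⟦ suc m ℤ.⊖ suc n ⟧ℤ            ≡⟨ ≡.cong ⟦_⟧ℤ (ℤₚ.[1+m]⊖[1+n]≡m⊖n m n) ⟩
    ⟦ m ℤ.⊖ n ⟧ℤ                    ≈⟨ ⟦⟧-⊖ m n ⟩
    ⟦ m ⟧ℕ - ⟦ n ⟧ℕ                 ≈⟨ shift 1# _ _ ⟩
    (1# + ⟦ m ⟧ℕ) - (1# + ⟦ n ⟧ℕ)   ≈⟨ +-cong (⟦⟧ℕ-+ 1 m) (-‿cong (⟦⟧ℕ-+ 1 n)) ⟨
    ⟦ suc m ⟧ℕ - ⟦ suc n ⟧ℕ         ∎

  ⟦⟧-+ : ∀ i j → ⟦ i ℤ.+ j ⟧ℤ ≈ ⟦ i ⟧ℤ + ⟦ j ⟧ℤ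
  ⟦⟧-+ (+ m)    (+ n)    = ⟦⟧ℕ-+ m n
  ⟦⟧-+ (+ m)    -[1+ n ] = ⟦⟧-⊖ m (suc n)
  ⟦⟧-+ -[1+ m ] (+ n)    = trans (⟦⟧-⊖ n (suc m)) (+-comm _ _)
  ⟦⟧-+ -[1+ m ] -[1+ n ] = begin
    - ⟦ suc (suc (m ℕ.+ n)) ⟧ℕ     ≡⟨ ≡.cong (λ k → - ⟦ suc k ⟧ℕ) (ℕₚ.+-suc m n) ⟨
    - ⟦ suc m ℕ.+ suc n ⟧ℕ         ≈⟨ -‿cong (⟦⟧ℕ-+ (suc m) (suc n)) ⟩
    - (⟦ suc m ⟧ℕ + ⟦ suc n ⟧ℕ)    ≈⟨ -‿+-comm _ _ ⟨
    - ⟦ suc m ⟧ℕ - ⟦ suc n ⟧ℕ      ∎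
    where import Data.Nat.Properties as ℕₚ

  ⟦⟧-*⁺ : ∀ m j → ⟦ + m ℤ.* j ⟧ℤ ≈ ⟦ m ⟧ℕ * ⟦ j ⟧ℤ
  ⟦⟧-*⁺ m (+ n)    = trans (reflexive (≡.cong ⟦_⟧ℤ (≡.sym (ℤₚ.pos-* m n)))) (⟦⟧ℕ-* m n)
  ⟦⟧-*⁺ m -[1+ n ] = begin
    ⟦ + m ℤ.* -[1+ n ] ⟧ℤ         ≡⟨ ≡.cong ⟦_⟧ℤ (ℤₚ.neg-distribʳ-* (+ m) (+ suc n)) ⟨
    ⟦ ℤ.- (+ m ℤ.* + suc n) ⟧ℤ    ≈⟨ ⟦⟧-neg (+ m ℤ.* + suc n) ⟩
    - ⟦ + m ℤ.* + suc n ⟧ℤ        ≈⟨ -‿cong (⟦⟧-*⁺ m (+ suc n)) ⟩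
    - (⟦ m ⟧ℕ * ⟦ suc n ⟧ℕ)       ≈⟨ -‿distribʳ-* _ _ ⟩
    ⟦ m ⟧ℕ * - ⟦ suc n ⟧ℕ         ∎

  ⟦⟧-* : ∀ i j → ⟦ i ℤ.* j ⟧ℤ ≈ ⟦ i ⟧ℤ * ⟦ j ⟧ℤ
  ⟦⟧-* (+ m)    j = ⟦⟧-*⁺ m j
  ⟦⟧-* -[1+ m ] j = begin
    ⟦ -[1+ m ] ℤ.* j ⟧ℤ          ≡⟨ ≡.cong ⟦_⟧ℤ (ℤₚ.neg-distribˡ-* (+ suc m) j) ⟨
    ⟦ ℤ.- (+ suc m ℤ.* j) ⟧ℤ     ≈⟨ ⟦⟧-neg (+ suc m ℤ.* j) ⟩
    - ⟦ + suc m ℤ.* j ⟧ℤ         ≈⟨ -‿cong (⟦⟧-*⁺ (suc m) j) ⟩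
    - (⟦ suc m ⟧ℕ * ⟦ j ⟧ℤ)      ≈⟨ -‿distribˡ-* _ _ ⟩
    - ⟦ suc m ⟧ℕ * ⟦ j ⟧ℤ        ∎

  ℤ⟶R : CommutativeRing.rawRing ℤₚ.+-*-commutativeRing -Raw-AlmostCommutative⟶ fromCommutativeRing R
  ℤ⟶R = record { ⟦_⟧ = ⟦_⟧ℤ ; +-homo = ⟦⟧-+ ; *-homo = ⟦⟧-* ; -‿homo = ⟦⟧-neg ; 0-homo = refl ; 1-homo = refl }

  -- Different integers may have equal images in R, so a negative answer carries no information and
  -- `Maybe` is the right result type.
  dec : ∀ i j → Maybe (⟦ i ⟧ℤ ≈ ⟦ j ⟧ℤ)
  dec i j with i ℤₚ.≟ j
  ... | yes i≡j = just (reflexive (≡.cong ⟦_⟧ℤ i≡j))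
  ... | no  _   = nothing

  open Algebra.Solver.Ring _ _ ℤ⟶R dec public using (solve; _:=_; _:+_; _:*_; _:-_; :-_; con)

-- Determinants

-- Opaque, so that the summands can be recovered from a sum by unification.
opaque
  fold : ∀ {a} {A : Set a} → (A → A → A) → A → ∀ {n} → (Fin n → A) → A
  fold = foldr

  fold-[] : ∀ {a} {A : Set a} (_∙_ : A → A → A) (ε : A) (f : Fin 0 → A) → fold _∙_ ε f ≡ ε
  fold-[] _∙_ ε f = ≡.refl

  fold-∷ : ∀ {a} {A : Set a} (_∙_ : A → A → A) (ε : A) {n} (f : Fin (suc n) → A) →
           fold _∙_ ε f ≡ (f zero ∙ fold _∙_ ε (f ∘ suc))
  fold-∷ _∙_ ε f = ≡.refl

module Sums {c ℓ} (R : CommutativeRing c ℓ) where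
  open CommutativeRing R hiding (zero)
  open Algebra.Properties.Ring ring
  open Relation.Binary.Reasoning.Setoid setoid
  module SemiringSum = Algebra.Properties.Semiring.Sum semiring

  sum : ∀ {n} → (Fin n → Carrier) → Carrier
  sum = fold _+_ 0#

  sum-[] : (f : Fin 0 → Carrier) → sum f ≈ 0#
  sum-[] f = reflexive (fold-[] _+_ 0# f)

  sum-∷ : ∀ {n} (f : Fin (suc n) → Carrier) → sum f ≈ f zero + sum (f ∘ suc)
  sum-∷ f = reflexive (fold-∷ _+_ 0# f)

  opaque
    unfolding fold

    sum-cong : ∀ {n} {f g : Fin n → Carrier} → (∀ i → f i ≈ g i) → sum f ≈ sum g
    sum-cong = SemiringSum.sum-cong-≋

    sum-zero : ∀ {n} {f : Fin n → Carrier} → (∀ i → f i ≈ 0#) → sum f ≈ 0#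
    sum-zero {n} f≈0 = trans (SemiringSum.sum-cong-≋ f≈0) (SemiringSum.sum-replicate-zero n)

    sum-+ : ∀ {n} (f g : Fin n → Carrier) → sum (λ i → f i + g i) ≈ sum f + sum g
    sum-+ = SemiringSum.∑-distrib-+

    sum-swap : ∀ {m n} (f : Fin m → Fin n → Carrier) →
               sum (λ i → sum (λ j → f i j)) ≈ sum (λ j → sum (λ i → f i j))
    sum-swap = SemiringSum.∑-comm

    sum-*ˡ : ∀ {n} x (f : Fin n → Carrier) → x * sum f ≈ sum (λ i → x * f i)
    sum-*ˡ = SemiringSum.*-distribˡ-sum

    sum-*ʳ : ∀ {n} x (f : Fin n → Carrier) → sum f * x ≈ sum (λ i → f i * x)
    sum-*ʳ = SemiringSum.*-distribʳ-sum

  sum-neg : ∀ {n} (f : Fin n → Carrier) → sum (λ i → - f i) ≈ - sum f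
  sum-neg f = trans (sum-cong (λ i → sym (-1*x≈-x (f i)))) (trans (sym (sum-*ˡ (- 1#) f)) (-1*x≈-x _))

  sum-linear : ∀ {n} a b (f g : Fin n → Carrier) → sum (λ i → a * f i + b * g i) ≈ a * sum f + b * sum g
  sum-linear a b f g = trans (sum-+ _ _) (sym (+-cong (sum-*ˡ a f) (sum-*ˡ b g)))

  δ : ∀ {n} → Fin n → Fin n → Carrier
  δ zero    zero    = 1#
  δ zero    (suc j) = 0#
  δ (suc i) zero    = 0#
  δ (suc i) (suc j) = δ i j

  δ-comm : ∀ {n} (i j : Fin n) → δ i j ≈ δ j i
  δ-comm zero    zero    = refl
  δ-comm zero    (suc j) = refl
  δ-comm (suc i) zero    = refl
  δ-comm (suc i) (suc j) = δ-comm i j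

  δ-refl : ∀ {n} (i : Fin n) → δ i i ≈ 1#
  δ-refl zero    = refl
  δ-refl (suc i) = δ-refl i

  δ-≢ : ∀ {n} {i j : Fin n} → i ≢ j → δ i j ≈ 0#
  δ-≢ {i = zero}  {zero}  i≢j = ⊥-elim (i≢j ≡.refl)
  δ-≢ {i = zero}  {suc j} i≢j = refl
  δ-≢ {i = suc i} {zero}  i≢j = refl
  δ-≢ {i = suc i} {suc j} i≢j = δ-≢ (i≢j ∘ ≡.cong suc)

  sum-δˡ : ∀ {n} (i : Fin n) (f : Fin n → Carrier) → sum (λ j → δ i j * f j) ≈ f i
  sum-δˡ zero f = begin
    sum (λ j → δ zero j * f j)                ≈⟨ sum-∷ _ ⟩
    1# * f zero + sum (λ j → 0# * f (suc j))  ≈⟨ +-cong (*-identityˡ _) (sum-zero (λ j → zeroˡ (f (suc j)))) ⟩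
    f zero + 0#                               ≈⟨ +-identityʳ _ ⟩
    f zero                                    ∎
  sum-δˡ (suc i) f = trans (sum-∷ _) (trans (+-congʳ (zeroˡ _)) (trans (+-identityˡ _) (sum-δˡ i (f ∘ suc))))

  sum-δʳ : ∀ {n} (i : Fin n) (f : Fin n → Carrier) → sum (λ j → f j * δ j i) ≈ f i
  sum-δʳ i f = trans (sum-cong (λ j → trans (*-comm _ _) (*-congʳ (δ-comm j i)))) (sum-δˡ i f)

module Determinants {c ℓ} (R : CommutativeRing c ℓ) where
  open CommutativeRing R hiding (zero)
  open Sums R
  open IntegerCoefficients R using (solve; _:=_; _:+_; _:*_; _:-_; :-_; con)
  open Algebra.Properties.Ring ring
  open Relation.Binary.Reasoning.Setoid setoid

  Rows : ℕ → ℕ → Set c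
  Rows k n = Fin k → Fin n → Carrier

  sign : ∀ {l} → Fin l → Carrier
  sign zero    = 1#
  sign (suc j) = - sign j

  det : ∀ {k} → Rows k k → Carrier
  det {zero}  A = 1#
  det {suc k} A = sum (λ j → sign j * (A zero j * det (λ r c → A (suc r) (punchIn j c))))

  infix 4 _≈ᵣ_ _≈[_]_
  _≈ᵣ_ : ∀ {k n} → Rows k n → Rows k n → Set ℓ
  A ≈ᵣ B = ∀ i j → A i j ≈ B i j

  _≈[_]_ : ∀ {k n} → Rows k n → Fin k → Rows k n → Set ℓ
  A ≈[ i ] B = ∀ r → r ≢ i → ∀ c → A r c ≈ B r c

  -- Stated for three matrices that agree off row i, instead of updates of a single matrix, so that
  -- the property passes to minors by restricting all three to the remaining columns.
  Linear : ∀ {k n} → (Rows k n → Carrier) → Set _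
  Linear {k} D = ∀ (i : Fin k) a b {A B C} → (∀ c → C i c ≈ a * A i c + b * B i c) →
                 A ≈[ i ] C → B ≈[ i ] C → D C ≈ a * D A + b * D B

  record IsAlternating {k n} (D : Rows k n → Carrier) : Set (c Level.⊔ ℓ) where
    field
      cong   : ∀ {A B} → A ≈ᵣ B → D A ≈ D B
      linear : Linear D
      alt    : ∀ {i j} → i ≢ j → ∀ {A} → (∀ c → A i c ≈ A j c) → D A ≈ 0#

  det-cong : ∀ {k} {A B : Rows k k} → A ≈ᵣ B → det A ≈ det B
  det-cong {zero}  A≈B = refl
  det-cong {suc k} A≈B = sum-cong λ j →
    *-congˡ {sign j} (*-cong (A≈B zero j) (det-cong (λ r c → A≈B (suc r) (punchIn j c))))

  det-linear : ∀ {k} → Linear (det {k})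
  det-linear {suc k} zero a b {A} {B} {C} C₀ A≈C B≈C = trans (sum-cong (λ j → begin
    sign j * (C zero j * det (λ r c → C (suc r) (punchIn j c)))
      ≈⟨ *-congˡ (*-congʳ (C₀ j)) ⟩
    sign j * ((a * A zero j + b * B zero j) * det (λ r c → C (suc r) (punchIn j c)))
      ≈⟨ solve 6 (λ s a x b y d → s :* ((a :* x :+ b :* y) :* d) := a :* (s :* (x :* d)) :+ b :* (s :* (y :* d)))
           refl (sign j) a (A zero j) b (B zero j) _ ⟩
    a * (sign j * (A zero j * det (λ r c → C (suc r) (punchIn j c)))) + b * (sign j * (B zero j * det (λ r c → C (suc r) (punchIn j c))))
      ≈⟨ +-cong (*-congˡ (*-congˡ (*-congˡ (det-cong (λ r c → A≈C (suc r) (λ ()) (punchIn j c))))))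
                (*-congˡ (*-congˡ (*-congˡ (det-cong (λ r c → B≈C (suc r) (λ ()) (punchIn j c)))))) ⟨
    a * (sign j * (A zero j * det (λ r c → A (suc r) (punchIn j c)))) + b * (sign j * (B zero j * det (λ r c → B (suc r) (punchIn j c)))) ∎))
    (sum-linear a b _ _)
  det-linear {suc k} (suc i) a b {A} {B} {C} Cᵢ A≈C B≈C = trans (sum-cong (λ j → begin
    sign j * (C zero j * det (λ r c → C (suc r) (punchIn j c)))
      ≈⟨ *-congˡ (*-congˡ (det-linear i a b (λ c → Cᵢ (punchIn j c))
           (λ r r≢i c → A≈C (suc r) (r≢i ∘ suc-injective) (punchIn j c))
           (λ r r≢i c → B≈C (suc r) (r≢i ∘ suc-injective) (punchIn j c)))) ⟩
    sign j * (C zero j * (a * det (λ r c → A (suc r) (punchIn j c)) + b * det (λ r c → B (suc r) (punchIn j c))))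
      ≈⟨ solve 6 (λ s x a m b n → s :* (x :* (a :* m :+ b :* n)) := a :* (s :* (x :* m)) :+ b :* (s :* (x :* n)))
           refl (sign j) (C zero j) a _ b _ ⟩
    a * (sign j * (C zero j * det (λ r c → A (suc r) (punchIn j c)))) + b * (sign j * (C zero j * det (λ r c → B (suc r) (punchIn j c))))
      ≈⟨ +-cong (*-congˡ (*-congˡ (*-congʳ (A≈C zero (λ ()) j)))) (*-congˡ (*-congˡ (*-congʳ (B≈C zero (λ ()) j)))) ⟨
    a * (sign j * (A zero j * det (λ r c → A (suc r) (punchIn j c)))) + b * (sign j * (B zero j * det (λ r c → B (suc r) (punchIn j c)))) ∎))
    (sum-linear a b _ _)

  -- `H j k` is the term of the ordered pair of columns (j, `punchIn j k`) in a double Laplace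
  -- expansion. The pairs (0, k + 1) and (k + 1, 0) carry opposite signs, so equality of their terms
  -- cancels them; the pairs of nonzero columns form a smaller instance.
  data Cancelling : ∀ {n} → (Fin (suc n) → Fin n → Carrier) → Set (c Level.⊔ ℓ) where
    base : ∀ {H : Fin 1 → Fin 0 → Carrier} → Cancelling H
    step : ∀ {n} {H : Fin (suc (suc n)) → Fin (suc n) → Carrier} →
           (∀ k → H zero k ≈ H (suc k) zero) → Cancelling (λ j k → H (suc j) (suc k)) → Cancelling H

  sum-cancelling : ∀ {n} {H : Fin (suc n) → Fin n → Carrier} → Cancelling H →
                   sum (λ j → sign j * sum (λ k → sign k * H j k)) ≈ 0#
  sum-cancelling {H = H} base = trans (sum-∷ _) (trans (+-cong (trans (*-identityˡ _) (sum-[] _)) (sum-[] _)) (+-identityʳ _))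
  sum-cancelling {suc n} {H} (step edge rest) = begin
    sum (λ j → sign j * sum (λ k → sign k * H j k))
      ≈⟨ sum-∷ _ ⟩
    1# * sum (λ k → sign k * H zero k) + sum (λ j → - sign j * sum (λ k → sign k * H (suc j) k))
      ≈⟨ +-cong (*-identityˡ _) (sum-cong λ j → split j) ⟩
    sum (λ k → sign k * H zero k) + sum (λ j → - (sign j * H (suc j) zero) + sign j * sum (λ k → sign k * H (suc j) (suc k)))
      ≈⟨ +-congˡ (trans (sum-+ _ _) (+-cong (sum-neg _) (sum-cancelling rest))) ⟩
    sum (λ k → sign k * H zero k) + (- sum (λ k → sign k * H (suc k) zero) + 0#)
      ≈⟨ +-congˡ (trans (+-identityʳ _) (-‿cong (sum-cong (λ k → *-congˡ (sym (edge k)))))) ⟩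
    sum (λ k → sign k * H zero k) - sum (λ k → sign k * H zero k)
      ≈⟨ -‿inverseʳ _ ⟩
    0# ∎
    where
    split : ∀ j → - sign j * sum (λ k → sign k * H (suc j) k) ≈
                  - (sign j * H (suc j) zero) + sign j * sum (λ k → sign k * H (suc j) (suc k))
    split j = begin
      - sign j * sum (λ k → sign k * H (suc j) k)
        ≈⟨ *-congˡ (sum-∷ _) ⟩
      - sign j * (1# * H (suc j) zero + sum (λ k → - sign k * H (suc j) (suc k)))
        ≈⟨ *-congˡ (+-congˡ (trans (sum-cong (λ k → sym (-‿distribˡ-* _ _))) (sum-neg _))) ⟩
      - sign j * (1# * H (suc j) zero - sum (λ k → sign k * H (suc j) (suc k)))
        ≈⟨ solve 3 (λ s h x → :- s :* (con (+ 1) :* h :+ :- x) := :- (s :* h) :+ s :* x) refl (sign j) _ _ ⟩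
      - (sign j * H (suc j) zero) + sign j * sum (λ k → sign k * H (suc j) (suc k)) ∎

  -- `W` is the minor of the lower rows on the columns left over by a pair. It depends only on the
  -- unordered pair, hence the symmetry of the terms. Once column zero is removed from the pairs it
  -- always belongs to the leftover columns, and `lift` puts it back.
  pairs-cancelling : ∀ N {a b : Fin (suc (suc N)) → Carrier} → (∀ i → a i ≈ b i) →
                     (W : (Fin N → Fin (suc (suc N))) → Carrier) → (∀ {f g} → (∀ i → f i ≡ g i) → W f ≈ W g) →
                     (H : Fin (suc (suc N)) → Fin (suc N) → Carrier) →
                     (∀ j k → H j k ≈ a j * (b (punchIn j k) * W (λ c → punchIn j (punchIn k c)))) →
                     Cancelling H
  pairs-cancelling N {a} {b} a≈b W W-ext H H≈ = step edge (rest N a≈b W W-ext H H≈)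
    where
    edge : ∀ k → H zero k ≈ H (suc k) zero
    edge k = begin
      H zero k                         ≈⟨ H≈ zero k ⟩
      a zero * (b (suc k) * _)         ≈⟨ *-cong (a≈b zero) (*-congʳ (sym (a≈b (suc k)))) ⟩
      b zero * (a (suc k) * _)         ≈⟨ solve 3 (λ x y z → x :* (y :* z) := y :* (x :* z)) refl (b zero) (a (suc k)) _ ⟩
      a (suc k) * (b zero * _)         ≈⟨ H≈ (suc k) zero ⟨
      H (suc k) zero                   ∎
    rest : ∀ N {a b : Fin (suc (suc N)) → Carrier} → (∀ i → a i ≈ b i) →
           (W : (Fin N → Fin (suc (suc N))) → Carrier) → (∀ {f g} → (∀ i → f i ≡ g i) → W f ≈ W g) →
           (H : Fin (suc (suc N)) → Fin (suc N) → Carrier) →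
           (∀ j k → H j k ≈ a j * (b (punchIn j k) * W (λ c → punchIn j (punchIn k c)))) →
           Cancelling (λ j k → H (suc j) (suc k))
    rest zero    a≈b W W-ext H H≈ = base
    rest (suc N) a≈b W W-ext H H≈ =
      pairs-cancelling N (a≈b ∘ suc) (W ∘ lift) (λ f≡g → W-ext (lift-ext f≡g)) (λ j k → H (suc j) (suc k)) λ j k →
      trans (H≈ (suc j) (suc k)) (*-congˡ (*-congˡ (W-ext (λ { zero → ≡.refl ; (suc c) → ≡.refl }))))
      where
      lift : (Fin N → Fin (suc (suc N))) → Fin (suc N) → Fin (suc (suc (suc N)))
      lift f zero    = zero
      lift f (suc c) = suc (f c)
      lift-ext : ∀ {f g} → (∀ i → f i ≡ g i) → ∀ i → lift f i ≡ lift g i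
      lift-ext f≡g zero    = ≡.refl
      lift-ext f≡g (suc i) = ≡.cong suc (f≡g i)

  det-alt₀₁ : ∀ {k} {A : Rows (suc (suc k)) (suc (suc k))} → (∀ c → A zero c ≈ A (suc zero) c) → det A ≈ 0#
  det-alt₀₁ {k} {A} A₀≈A₁ = begin
    det A
      ≈⟨ sum-cong (λ j → *-congˡ {sign j} (trans (sum-*ˡ (A zero j) _) (sum-cong (λ k →
           solve 4 (λ x s y d → x :* (s :* (y :* d)) := s :* (x :* (y :* d))) refl
             (A zero j) (sign k) (A (suc zero) (punchIn j k)) (W (λ c → punchIn j (punchIn k c))))))) ⟩
    sum (λ j → sign j * sum (λ k → sign k * (A zero j * (A (suc zero) (punchIn j k) * W (λ c → punchIn j (punchIn k c))))))
      ≈⟨ sum-cancelling (pairs-cancelling k A₀≈A₁ W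
           (λ f≡g → det-cong (λ r c → reflexive (≡.cong (A (suc (suc r))) (f≡g c)))) _ (λ j k → refl)) ⟩
    0# ∎
    where
    W : (Fin k → Fin (suc (suc k))) → Carrier
    W f = det (λ r c → A (suc (suc r)) (f c))

-- Alternating forms and Cramer's rule

module AlternatingForms {c ℓ} (R : CommutativeRing c ℓ) where
  open CommutativeRing R hiding (zero)
  open Sums R
  open Determinants R
  open Algebra.Properties.Ring ring
  open Relation.Binary.Reasoning.Setoid setoid

  -- Polarisation: expand the form on u + v, u + v in the two top rows. Vanishing is assumed only
  -- for equal top rows, which is all that is known of determinants where this is first applied.
  swap₀₁ : ∀ {k n} {D : Rows (suc (suc k)) n → Carrier} → (∀ {A B} → A ≈ᵣ B → D A ≈ D B) → Linear D →
           (∀ {A} → (∀ c → A zero c ≈ A (suc zero) c) → D A ≈ 0#) →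
           ∀ u v rest → D (u ∷ v ∷ rest) ≈ - D (v ∷ u ∷ rest)
  swap₀₁ {D = D} cong linear alt₀₁ u v rest = +-inverseˡ-unique _ _ (begin
    M u v + M v u                        ≈⟨ +-cong (+-identityˡ _) (+-identityʳ _) ⟨
    (0# + M u v) + (M v u + 0#)          ≈⟨ +-cong (+-congʳ (alt₀₁ (λ _ → refl))) (+-congˡ (alt₀₁ (λ _ → refl))) ⟨
    (M u u + M u v) + (M v u + M v v)    ≈⟨ +-cong (split₁ u) (split₁ v) ⟨
    M u w + M v w                        ≈⟨ split₀ ⟨
    M w w                                ≈⟨ alt₀₁ (λ _ → refl) ⟩
    0#                                   ∎)
    where
    M : (Fin _ → Carrier) → (Fin _ → Carrier) → Carrier
    M x y = D (x ∷ y ∷ rest)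
    w : Fin _ → Carrier
    w c = u c + v c
    one*-+ : ∀ x y → x + y ≈ 1# * x + 1# * y
    one*-+ x y = +-cong (sym (*-identityˡ x)) (sym (*-identityˡ y))
    split₁ : ∀ x → M x w ≈ M x u + M x v
    split₁ x = trans (linear (suc zero) 1# 1# (λ c → one*-+ (u c) (v c)) (off x u) (off x v)) (sym (one*-+ _ _))
      where
      off : ∀ x y → (x ∷ y ∷ rest) ≈[ suc zero ] (x ∷ w ∷ rest)
      off x y zero          _   c = refl
      off x y (suc zero)    r≢1 c = ⊥-elim (r≢1 ≡.refl)
      off x y (suc (suc r)) _   c = refl
    split₀ : M w w ≈ M u w + M v w
    split₀ = trans (linear zero 1# 1# (λ c → one*-+ (u c) (v c)) (off u) (off v)) (sym (one*-+ _ _))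
      where
      off : ∀ x → (x ∷ w ∷ rest) ≈[ zero ] (w ∷ w ∷ rest)
      off x zero    r≢0 c = ⊥-elim (r≢0 ≡.refl)
      off x (suc r) _   c = refl

  ∷-η₂ : ∀ {k n} (A : Rows (suc (suc k)) n) → A ≈ᵣ (A zero ∷ A (suc zero) ∷ λ r → A (suc (suc r)))
  ∷-η₂ A zero          c = refl
  ∷-η₂ A (suc zero)    c = refl
  ∷-η₂ A (suc (suc r)) c = refl

  -- Swapping the two top rows moves the equal rows to positions below the first. Both then survive
  -- in every minor of the expansion along the first row, and these minors vanish by the assumption
  -- on smaller determinants.
  det-alt₀ : ∀ {k} → (∀ {i j : Fin (suc k)} → i ≢ j → (A : Rows (suc k) (suc k)) → (∀ c → A i c ≈ A j c) → det A ≈ 0#) →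
             ∀ j (A : Rows (suc (suc k)) (suc (suc k))) → (∀ c → A zero c ≈ A (suc j) c) → det A ≈ 0#
  det-alt₀ IH zero    A A₀≈Aⱼ = det-alt₀₁ {A = A} A₀≈Aⱼ
  det-alt₀ {k} IH (suc j) A A₀≈Aⱼ = begin
    det A                                                ≈⟨ det-cong {A = A} (∷-η₂ A) ⟩
    det (A zero ∷ A (suc zero) ∷ λ r → A (suc (suc r)))  ≈⟨ swap₀₁ det-cong det-linear (λ {B} → det-alt₀₁ {A = B}) (A zero) (A (suc zero)) (λ r → A (suc (suc r))) ⟩
    - det B                                              ≈⟨ -‿cong (sum-zero (λ m → trans (*-congˡ {sign m} (trans (*-congˡ
        (IH {zero} {suc j} (λ ()) (λ r c → B (suc r) (punchIn m c)) (λ c → A₀≈Aⱼ (punchIn m c)))) (zeroʳ _))) (zeroʳ _))) ⟩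
    - 0#                                                 ≈⟨ -0#≈0# ⟩
    0#                                                   ∎
    where
    B : Rows (suc (suc k)) (suc (suc k))
    B = A (suc zero) ∷ A zero ∷ λ r → A (suc (suc r))

  det-alt : ∀ {k} {i j : Fin k} → i ≢ j → (A : Rows k k) → (∀ c → A i c ≈ A j c) → det A ≈ 0#
  det-alt {suc k}       {zero}  {zero}  i≢j A Aᵢ≈Aⱼ = ⊥-elim (i≢j ≡.refl)
  det-alt {suc (suc k)} {zero}  {suc j} i≢j A Aᵢ≈Aⱼ = det-alt₀ det-alt j A Aᵢ≈Aⱼ
  det-alt {suc (suc k)} {suc i} {zero}  i≢j A Aᵢ≈Aⱼ = det-alt₀ det-alt i A (λ c → sym (Aᵢ≈Aⱼ c))
  det-alt {suc k}       {suc i} {suc j} i≢j A Aᵢ≈Aⱼ = sum-zero (λ m → trans (*-congˡ {sign m} (trans (*-congˡ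
    (det-alt {k} {i} {j} (i≢j ∘ ≡.cong suc) _ (λ c → Aᵢ≈Aⱼ (punchIn m c)))) (zeroʳ _))) (zeroʳ _))

  det-alternating : ∀ {k} → IsAlternating (det {k})
  det-alternating = record { cong = det-cong ; linear = det-linear ; alt = λ i≢j {A} → det-alt i≢j A }

  infixl 9 _[_≔_]
  _[_≔_] : ∀ {k n} → Rows k n → Fin k → (Fin n → Carrier) → Rows k n
  A [ i ≔ v ] = updateAt A i (const v)

  ≔-same : ∀ {k n} (A : Rows k n) i v c → (A [ i ≔ v ]) i c ≈ v c
  ≔-same A i v c = reflexive (≡.cong (_$ c) (updateAt-updates i A))

  ≔-other : ∀ {k n} (A : Rows k n) i v → (A [ i ≔ v ]) ≈[ i ] A
  ≔-other A i v r r≢i c = reflexive (≡.cong (_$ c) (updateAt-minimal r i A r≢i))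

  module _ {k n} {D : Rows k n → Carrier} (alternating : IsAlternating D) where
    open IsAlternating alternating

    linear-sum : ∀ (i : Fin k) {m} (x : Fin m → Carrier) (v : Fin m → Fin n → Carrier) A →
                 D (A [ i ≔ (λ c → sum (λ j → x j * v j c)) ]) ≈ sum (λ j → x j * D (A [ i ≔ v j ]))
    linear-sum i {zero} x v A = begin
      D (A [ i ≔ (λ c → sum (λ j → x j * v j c)) ])
        ≈⟨ linear i 0# 0# {A} {A} (λ c → trans (≔-same A i _ c) (trans (sum-[] _)
             (sym (trans (+-cong (zeroˡ _) (zeroˡ _)) (+-identityʳ _)))))
             (λ r r≢i c → sym (≔-other A i _ r r≢i c)) (λ r r≢i c → sym (≔-other A i _ r r≢i c)) ⟩
      0# * D A + 0# * D A                ≈⟨ trans (+-cong (zeroˡ _) (zeroˡ _)) (+-identityʳ _) ⟩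
      0#                                 ≈⟨ sum-[] _ ⟨
      sum (λ j → x j * D (A [ i ≔ v j ])) ∎
    linear-sum i {suc m} x v A = begin
      D (A [ i ≔ (λ c → sum (λ j → x j * v j c)) ])
        ≈⟨ linear i (x zero) 1# {A [ i ≔ v zero ]} {A [ i ≔ s ]}
             (λ c → trans (≔-same A i _ c) (trans (sum-∷ _)
               (+-cong (*-congˡ (sym (≔-same A i _ c))) (trans (sym (*-identityˡ _)) (*-congˡ (sym (≔-same A i _ c)))))))
             (off (v zero)) (off s) ⟩
      x zero * D (A [ i ≔ v zero ]) + 1# * D (A [ i ≔ s ])
        ≈⟨ +-congˡ (trans (*-identityˡ _) (linear-sum i (x ∘ suc) (v ∘ suc) A)) ⟩
      x zero * D (A [ i ≔ v zero ]) + sum (λ j → x (suc j) * D (A [ i ≔ v (suc j) ]))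
        ≈⟨ sum-∷ _ ⟨
      sum (λ j → x j * D (A [ i ≔ v j ])) ∎
      where
      s : Fin n → Carrier
      s c = sum (λ j → x (suc j) * v (suc j) c)
      off : ∀ u {w} → (A [ i ≔ u ]) ≈[ i ] (A [ i ≔ w ])
      off u r r≢i c = trans (≔-other A i _ r r≢i c) (sym (≔-other A i _ r r≢i c))

    replace-row : ∀ i j A → D (A [ j ≔ A i ]) ≈ δ i j * D A
    replace-row i j A with i Finₚ.≟ j
    ... | yes ≡.refl = begin
      D (A [ j ≔ A j ])  ≈⟨ cong (λ r c → same r c) ⟩
      D A                ≈⟨ *-identityˡ _ ⟨
      1# * D A           ≈⟨ *-congʳ (δ-refl j) ⟨
      δ j j * D A        ∎
      where
      same : ∀ r c → (A [ j ≔ A j ]) r c ≈ A r c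
      same r c with r Finₚ.≟ j
      ... | yes ≡.refl = ≔-same A j _ c
      ... | no r≢j     = ≔-other A j _ r r≢j c
    ... | no i≢j = begin
      D (A [ j ≔ A i ])  ≈⟨ alt i≢j (λ c → trans (≔-other A j _ i i≢j c) (sym (≔-same A j _ c))) ⟩
      0#                 ≈⟨ zeroˡ _ ⟨
      0# * D A           ≈⟨ *-congʳ (δ-≢ i≢j) ⟨
      δ i j * D A        ∎

  -- Replacing row j by the combination of all rows with coefficients x multiplies the determinant
  -- by `x j`, since the other rows contribute repeated rows. Here the new row is zero. The form
  -- without division is valid over every commutative ring.
  cramer : ∀ {k} (A : Rows k k) (x : Fin k → Carrier) → (∀ c → sum (λ i → x i * A i c) ≈ 0#) → ∀ j → x j * det A ≈ 0#
  cramer A x xA≈0 j = begin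
    x j * det A                                       ≈⟨ sum-δʳ j (λ i → x i * det A) ⟨
    sum (λ i → x i * det A * δ i j)                   ≈⟨ sum-cong (λ i → trans (*-assoc _ _ _) (*-congˡ
                                                           (trans (*-comm _ _) (sym (replace-row det-alternating i j A))))) ⟩
    sum (λ i → x i * det (A [ j ≔ A i ]))             ≈⟨ linear-sum det-alternating j x A A ⟨
    det (A [ j ≔ (λ c → sum (λ i → x i * A i c)) ])   ≈⟨ det-linear j 0# 0# {A} {A} (λ c → trans (≔-same A j _ c) (trans (xA≈0 c)
                                                           (sym (trans (+-cong (zeroˡ _) (zeroˡ _)) (+-identityʳ _)))))
                                                           (λ r r≢i c → sym (≔-other A j _ r r≢i c)) (λ r r≢i c → sym (≔-other A j _ r r≢i c)) ⟩
    0# * det A + 0# * det A                           ≈⟨ trans (+-cong (zeroˡ _) (zeroˡ _)) (+-identityʳ _) ⟩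
    0#                                                ∎

punchIn-elim : ∀ {p n} (j : Fin (suc n)) (P : Fin (suc n) → Set p) → P j → (∀ c → P (punchIn j c)) → ∀ c → P c
punchIn-elim zero    P Pj Pp zero    = Pj
punchIn-elim zero    P Pj Pp (suc c) = Pp c
punchIn-elim {n = suc n} (suc j) P Pj Pp zero    = Pp zero
punchIn-elim {n = suc n} (suc j) P Pj Pp (suc c) = punchIn-elim j (P ∘ suc) Pj (Pp ∘ suc) c

-- Uniqueness of alternating forms and determinants of products

module DeterminantProduct {c ℓ} (R : CommutativeRing c ℓ) where
  open CommutativeRing R hiding (zero)
  open Sums R
  open Determinants R
  open AlternatingForms R
  open IntegerCoefficients R using (solve; _:=_; _:+_; _:*_)
  open Algebra.Properties.Ring ring
  open Relation.Binary.Reasoning.Setoid setoid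

  private
    change-rows : ∀ {k n} (v : Fin n → Carrier) (F : Rows k n → Carrier) → (∀ {A B} → A ≈ᵣ B → F A ≈ F B) →
                  (∀ i t {A B} → A ≈[ i ] B → (∀ c → B i c ≈ A i c + t * v c) → F A ≈ F B) →
                  (t : Fin k → Carrier) → ∀ {A B} → (∀ i c → B i c ≈ A i c + t i * v c) → F A ≈ F B
    change-rows {zero}  v F cong add-row t B≈ = cong (λ ())
    change-rows {suc k} v F cong add-row t {A} {B} B≈ = begin
      F A                  ≈⟨ add-row zero (t zero) (λ { zero r≢0 c → ⊥-elim (r≢0 ≡.refl) ; (suc r) _ c → refl }) (B≈ zero) ⟩
      F (B zero ∷ A ∘ suc) ≈⟨ change-rows v (λ X → F (B zero ∷ X))
                                (λ X≈Y → cong (λ { zero c → refl ; (suc r) c → X≈Y r c }))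
                                (λ i t X≈Y Yᵢ → add-row (suc i) t
                                  (λ { zero _ c → refl ; (suc r) r≢i c → X≈Y r (r≢i ∘ ≡.cong suc) c }) Yᵢ)
                                (t ∘ suc) {A ∘ suc} {B ∘ suc} (B≈ ∘ suc) ⟩
      F (B zero ∷ B ∘ suc) ≈⟨ cong (λ { zero c → refl ; (suc r) c → refl }) ⟩
      F B                  ∎

  -- The unit row δ j on top and a zero column j inserted below. Composition with it lowers the size
  -- of an alternating form by one, which drives the induction for uniqueness.
  border : ∀ {k n} → Fin (suc n) → Rows k n → Rows (suc k) (suc n)
  border j M = δ j ∷ λ r → insertAt (M r) j 0#

  module _ {n : ℕ} (j : Fin (suc n)) where
    insertAt-cases : ∀ {x y : Fin (suc n) → Carrier} → x j ≈ y j → (∀ c → x (punchIn j c) ≈ y (punchIn j c)) → ∀ c → x c ≈ y c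
    insertAt-cases {x} {y} = punchIn-elim j (λ c → x c ≈ y c)

    insertAt-≈ : ∀ {u v : Fin n → Carrier} → (∀ c → u c ≈ v c) → ∀ c → insertAt u j 0# c ≈ insertAt v j 0# c
    insertAt-≈ {u} {v} u≈v = insertAt-cases
      (reflexive (≡.trans (insertAt-lookup u j 0#) (≡.sym (insertAt-lookup v j 0#))))
      (λ c → trans (reflexive (insertAt-punchIn u j 0# c)) (trans (u≈v c) (reflexive (≡.sym (insertAt-punchIn v j 0# c)))))

  border-alternating : ∀ {k n} {D : Rows (suc k) (suc n) → Carrier} → IsAlternating D → ∀ j → IsAlternating (D ∘ border j)
  border-alternating {n = n} {D} alternating j = record
    { cong   = λ A≈B → cong (λ { zero c → refl ; (suc r) → insertAt-≈ j (A≈B r) })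
    ; linear = λ i a b {A} {B} {C} Cᵢ A≈C B≈C → linear (suc i) a b
        (insertAt-cases j
          (trans (reflexive (insertAt-lookup (C i) j 0#)) (sym (trans
            (+-cong (trans (*-congˡ (reflexive (insertAt-lookup (A i) j 0#))) (zeroʳ a))
                    (trans (*-congˡ (reflexive (insertAt-lookup (B i) j 0#))) (zeroʳ b))) (+-identityʳ 0#))))
          (λ c → trans (reflexive (insertAt-punchIn (C i) j 0# c)) (trans (Cᵢ c)
            (+-cong (*-congˡ (reflexive (≡.sym (insertAt-punchIn (A i) j 0# c))))
                    (*-congˡ (reflexive (≡.sym (insertAt-punchIn (B i) j 0# c))))))))
        (off A≈C) (off B≈C)
    ; alt    = λ i≢j {A} Aᵢ≈Aⱼ → alt (i≢j ∘ suc-injective) (insertAt-≈ j Aᵢ≈Aⱼ)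
    }
    where
    open IsAlternating alternating
    off : ∀ {i A C} → A ≈[ i ] C → border j A ≈[ suc i ] border j C
    off A≈C zero    _   c = refl
    off A≈C (suc r) r≢i   = insertAt-≈ j (A≈C r (r≢i ∘ ≡.cong suc))

  -- With δ j as top row, subtracting `A r j` times it from each lower row clears column j; every
  -- correction term has a repeated row.
  border-minor : ∀ {k} {D : Rows (suc k) (suc k) → Carrier} → IsAlternating D → ∀ j (A : Rows k (suc k)) →
                 D (δ j ∷ A) ≈ D (border j (λ r c → A r (punchIn j c)))
  border-minor {D = D} alternating j A = change-rows (δ j) (λ X → D (δ j ∷ X))
    (λ X≈Y → cong (λ { zero c → refl ; (suc r) c → X≈Y r c })) add-row (λ r → - A r j) λ r → insertAt-cases j
      (trans (reflexive (insertAt-lookup _ j 0#)) (sym (begin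
        A r j + - A r j * δ j j  ≈⟨ +-congˡ (trans (*-congˡ (δ-refl j)) (*-identityʳ _)) ⟩
        A r j - A r j            ≈⟨ -‿inverseʳ _ ⟩
        0#                       ∎)))
      (λ c → trans (reflexive (insertAt-punchIn _ j 0# c)) (sym (begin
        A r (punchIn j c) + - A r j * δ j (punchIn j c)  ≈⟨ +-congˡ (trans (*-congˡ (δ-≢ (punchInᵢ≢i j c ∘ ≡.sym))) (zeroʳ _)) ⟩
        A r (punchIn j c) + 0#                           ≈⟨ +-identityʳ _ ⟩
        A r (punchIn j c)                                ∎)))
    where
    open IsAlternating alternating
    add-row : ∀ i t {A B} → A ≈[ i ] B → (∀ c → B i c ≈ A i c + t * δ j c) → D (δ j ∷ A) ≈ D (δ j ∷ B)
    add-row i t {A} {B} A≈B Bᵢ = sym (begin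
      D (δ j ∷ B)                                      ≈⟨ linear (suc i) 1# t {δ j ∷ A} {δ j ∷ A [ i ≔ δ j ]}
                                                            (λ c → trans (Bᵢ c) (+-cong (sym (*-identityˡ _)) (*-congˡ (sym (≔-same A i _ c)))))
                                                            (λ { zero _ c → refl ; (suc r) r≢i c → A≈B r (r≢i ∘ ≡.cong suc) c })
                                                            (λ { zero _ c → refl ; (suc r) r≢i c → trans (≔-other A i _ r (r≢i ∘ ≡.cong suc) c)
                                                                                                     (A≈B r (r≢i ∘ ≡.cong suc) c) }) ⟩
      1# * D (δ j ∷ A) + t * D (δ j ∷ A [ i ≔ δ j ])   ≈⟨ +-cong (*-identityˡ _) (trans (*-congˡ
                                                            (alt {zero} {suc i} (λ ()) (λ c → sym (≔-same A i _ c)))) (zeroʳ t)) ⟩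
      D (δ j ∷ A) + 0#                                 ≈⟨ +-identityʳ _ ⟩
      D (δ j ∷ A)                                      ∎)

  -- The row δ j has to move down past j rows, each transposition giving a sign. One swap exchanges
  -- it with δ zero, and the others take place under the smaller form `D ∘ border zero`.
  border-δ : ∀ {k} {D : Rows (suc k) (suc k) → Carrier} → IsAlternating D → ∀ j → D (border j δ) ≈ sign j * D δ
  border-δ {D = D} alternating zero = trans (cong border₀-δ) (sym (*-identityˡ _))
    where
    open IsAlternating alternating
    border₀-δ : border zero δ ≈ᵣ δ
    border₀-δ zero    c       = refl
    border₀-δ (suc r) zero    = refl
    border₀-δ (suc r) (suc c) = refl
  border-δ {suc k} {D} alternating (suc j) = begin
    D (border (suc j) δ)                              ≈⟨ cong rows ⟩
    D (δ (suc j) ∷ δ zero ∷ rest)                     ≈⟨ swap₀₁ cong linear (alt (λ ())) (δ (suc j)) (δ zero) rest ⟩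
    - D (δ zero ∷ δ (suc j) ∷ rest)                   ≈⟨ -‿cong (cong rows′) ⟩
    - D (border zero (border j δ))                    ≈⟨ -‿cong (border-δ (border-alternating alternating zero) j) ⟩
    - (sign j * D (border zero δ))                    ≈⟨ -‿cong (*-congˡ (trans (border-δ alternating zero) (*-identityˡ _))) ⟩
    - (sign j * D δ)                                  ≈⟨ -‿distribˡ-* _ _ ⟩
    sign (suc j) * D δ                                ∎
    where
    open IsAlternating alternating
    rest : Rows k (suc (suc k))
    rest r = insertAt (δ (suc r)) (suc j) 0#
    rows : border (suc j) δ ≈ᵣ (δ (suc j) ∷ δ zero ∷ rest)
    rows zero          c       = refl
    rows (suc zero)    zero    = refl
    rows (suc zero)    (suc c) = insertAt-cases j {x = insertAt (λ _ → 0#) j 0#} {y = λ _ → 0#} (reflexive (insertAt-lookup _ j 0#))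
                                   (λ c → reflexive (insertAt-punchIn _ j 0# c)) c
    rows (suc (suc r)) c       = refl
    rows′ : (δ zero ∷ δ (suc j) ∷ rest) ≈ᵣ border zero (border j δ)
    rows′ zero          c       = refl
    rows′ (suc zero)    zero    = refl
    rows′ (suc zero)    (suc c) = refl
    rows′ (suc (suc r)) zero    = refl
    rows′ (suc (suc r)) (suc c) = refl

  -- Writing the first row as a combination of the δ j reproduces the Laplace expansion: each
  -- `D ∘ border j` is an alternating form of smaller size, and its value at δ supplies the sign.
  alternating-unique : ∀ {k} {D : Rows k k → Carrier} → IsAlternating D → ∀ A → D A ≈ det A * D δ
  alternating-unique {zero}  alternating A = trans (IsAlternating.cong alternating (λ ())) (sym (*-identityˡ _))
  alternating-unique {suc k} {D} alternating A = begin
    D A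
      ≈⟨ cong (λ { zero c → sym (sum-δʳ c (A zero)) ; (suc r) c → refl }) ⟩
    D (A [ zero ≔ (λ c → sum (λ j → A zero j * δ j c)) ])
      ≈⟨ linear-sum alternating zero (A zero) δ A ⟩
    sum (λ j → A zero j * D (A [ zero ≔ δ j ]))
      ≈⟨ sum-cong (λ j → *-congˡ (cong (λ { zero c → refl ; (suc r) c → refl }))) ⟩
    sum (λ j → A zero j * D (δ j ∷ A ∘ suc))
      ≈⟨ sum-cong (λ j → *-congˡ {A zero j} (trans (border-minor alternating j (A ∘ suc))
           (trans (alternating-unique (border-alternating alternating j) _) (*-congˡ (border-δ alternating j))))) ⟩
    sum (λ j → A zero j * (det (λ r c → A (suc r) (punchIn j c)) * (sign j * D δ)))
      ≈⟨ sum-cong (λ j → solve 4 (λ x d s e → x :* (d :* (s :* e)) := s :* (x :* d) :* e) refl (A zero j) _ (sign j) (D δ)) ⟩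
    sum (λ j → sign j * (A zero j * det (λ r c → A (suc r) (punchIn j c))) * D δ)
      ≈⟨ sum-*ʳ (D δ) _ ⟨
    det A * D δ ∎
    where open IsAlternating alternating

  -- As a function of A the left side is an alternating form with value `det B` at the identity, so
  -- uniqueness applies.
  det-* : ∀ {k} (A B : Rows k k) → det (λ i c → sum (λ l → A i l * B l c)) ≈ det A * det B
  det-* {k} A B = trans (alternating-unique {D = D} alternating A)
    (*-congˡ (det-cong (λ i c → sum-δˡ i (λ l → B l c))))
    where
    D : Rows k k → Carrier
    D X = det (λ i c → sum (λ l → X i l * B l c))
    alternating : IsAlternating D
    alternating = record
      { cong   = λ X≈Y → det-cong (λ i c → sum-cong (λ l → *-congʳ (X≈Y i l)))
      ; linear = λ i a b {X} {Y} {Z} Zᵢ X≈Z Y≈Z → det-linear i a b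
          (λ c → trans (sum-cong (λ l → trans (*-congʳ (Zᵢ l))
              (solve 5 (λ a x b y z → (a :* x :+ b :* y) :* z := a :* (x :* z) :+ b :* (y :* z)) refl a (X i l) b (Y i l) (B l c))))
            (sum-linear a b _ _))
          (λ r r≢i c → sum-cong (λ l → *-congʳ (X≈Z r r≢i l)))
          (λ r r≢i c → sum-cong (λ l → *-congʳ (Y≈Z r r≢i l)))
      ; alt    = λ i≢j {X} Xᵢ≈Xⱼ → det-alt i≢j _ (λ c → sum-cong (λ l → *-congʳ (Xᵢ≈Xⱼ l)))
      }

  det-δ : ∀ k → det (δ {k}) ≈ 1#
  det-δ zero    = refl
  det-δ (suc k) = begin
    det (δ {suc k})  ≈⟨ sum-∷ _ ⟩
    1# * (1# * det (δ {k})) + sum (λ j → - sign j * (0# * det (λ r c → δ (suc r) (punchIn (suc j) c))))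
      ≈⟨ +-cong (trans (*-identityˡ _) (trans (*-identityˡ _) (det-δ k))) (sum-zero (λ j → trans (*-congˡ (zeroˡ _)) (zeroʳ _))) ⟩
    1# + 0#          ≈⟨ +-identityʳ _ ⟩
    1#               ∎

-- Traces of p-th powers

data Exponent : Set where
  two three : Exponent

-- The operation is a parameter: with multiplication this is xᵖ, with addition it is px, so one
-- function serves for p-th powers in any ring and for characteristic p.
power : ∀ {a} {A : Set a} → (A → A → A) → Exponent → A → A
power _∙_ two   x = x ∙ x
power _∙_ three x = x ∙ (x ∙ x)

module Frobenius {c ℓ} (R : CommutativeRing c ℓ) where
  open CommutativeRing R hiding (zero)
  open Sums R
  open IntegerCoefficients R using (solve; _:=_; _:+_; _:*_)
  open Relation.Binary.Reasoning.Setoid setoid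

  HasCharacteristic : Exponent → Set _
  HasCharacteristic e = ∀ x → power _+_ e x ≈ 0#

  infixr 8 _^_
  _^_ : Carrier → Exponent → Carrier
  x ^ e = power _*_ e x

  ^-cong : ∀ e {x y} → x ≈ y → x ^ e ≈ y ^ e
  ^-cong two   x≈y = *-cong x≈y x≈y
  ^-cong three x≈y = *-cong x≈y (*-cong x≈y x≈y)

  0^ : ∀ e → 0# ^ e ≈ 0#
  0^ two   = zeroˡ _
  0^ three = zeroˡ _

  ^-distrib-* : ∀ e x y → (x * y) ^ e ≈ x ^ e * y ^ e
  ^-distrib-* two   = solve 2 (λ x y → (x :* y) :* (x :* y) := (x :* x) :* (y :* y)) refl
  ^-distrib-* three = solve 2 (λ x y → (x :* y) :* ((x :* y) :* (x :* y)) := (x :* (x :* x)) :* (y :* (y :* y))) refl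

  ^-+ : ∀ e → HasCharacteristic e → ∀ x y → (x + y) ^ e ≈ x ^ e + y ^ e
  ^-+ two char x y = begin
    (x + y) * (x + y)                       ≈⟨ solve 2 (λ x y → (x :+ y) :* (x :+ y) := x :* x :+ y :* y :+ (x :* y :+ x :* y)) refl x y ⟩
    x * x + y * y + (x * y + x * y)         ≈⟨ +-congˡ (char (x * y)) ⟩
    x * x + y * y + 0#                      ≈⟨ +-identityʳ _ ⟩
    x * x + y * y                           ∎
  ^-+ three char x y = begin
    (x + y) * ((x + y) * (x + y))
      ≈⟨ solve 2 (λ x y → let z = x :* x :* y :+ x :* y :* y in
           (x :+ y) :* ((x :+ y) :* (x :+ y)) := x :* (x :* x) :+ y :* (y :* y) :+ (z :+ (z :+ z))) refl x y ⟩
    x * (x * x) + y * (y * y) + _           ≈⟨ +-congˡ (char _) ⟩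
    x * (x * x) + y * (y * y) + 0#          ≈⟨ +-identityʳ _ ⟩
    x * (x * x) + y * (y * y)               ∎

  sum₂ : ∀ {m n} → (Fin m → Fin n → Carrier) → Carrier
  sum₂ f = sum (λ i → sum (f i))

  sum₂-∷ : ∀ {m n} (f : Fin (suc m) → Fin (suc n) → Carrier) →
           sum₂ f ≈ f zero zero + (sum (λ j → f zero (suc j)) + (sum (λ i → f (suc i) zero) + sum₂ (λ i j → f (suc i) (suc j))))
  sum₂-∷ f = begin
    sum₂ f                                                            ≈⟨ sum-∷ _ ⟩
    sum (f zero) + sum (λ i → sum (f (suc i)))                        ≈⟨ +-cong (sum-∷ _) (trans (sum-cong (λ i → sum-∷ _)) (sum-+ _ _)) ⟩
    (f zero zero + sum (λ j → f zero (suc j))) + (sum (λ i → f (suc i) zero) + sum₂ (λ i j → f (suc i) (suc j)))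
      ≈⟨ +-assoc _ _ _ ⟩
    f zero zero + (sum (λ j → f zero (suc j)) + (sum (λ i → f (suc i) zero) + sum₂ (λ i j → f (suc i) (suc j)))) ∎

  sum-symmetric : HasCharacteristic two → ∀ {n} (f : Fin n → Fin n → Carrier) → (∀ i j → f i j ≈ f j i) →
                  sum₂ f ≈ sum (λ i → f i i)
  sum-symmetric char {zero}  f f-sym = trans (sum-[] _) (sym (sum-[] _))
  sum-symmetric char {suc n} f f-sym = begin
    sum₂ f
      ≈⟨ sum₂-∷ f ⟩
    f zero zero + (sum (λ j → f zero (suc j)) + (sum (λ i → f (suc i) zero) + sum₂ (λ i j → f (suc i) (suc j))))
      ≈⟨ +-congˡ (+-cong (sum-cong (λ j → f-sym zero (suc j))) (+-congˡ (sum-symmetric char _ (λ i j → f-sym (suc i) (suc j))))) ⟩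
    f zero zero + (X + (X + sum (λ i → f (suc i) (suc i))))
      ≈⟨ +-congˡ (trans (sym (+-assoc _ _ _)) (trans (+-congʳ (char X)) (+-identityˡ _))) ⟩
    f zero zero + sum (λ i → f (suc i) (suc i))
      ≈⟨ sum-∷ _ ⟨
    sum (λ i → f i i) ∎
    where
    X = sum (λ i → f (suc i) zero)

  sum₃ : ∀ {n} → (Fin n → Fin n → Fin n → Carrier) → Carrier
  sum₃ f = sum (λ i → sum₂ (f i))

  -- Nonconstant triples fall into rotation orbits of size three. In the induction `X` collects the
  -- triples with zeros in exactly two places and `Y` those with a zero in exactly one; each occurs
  -- three times.
  sum-cyclic : HasCharacteristic three → ∀ {n} (f : Fin n → Fin n → Fin n → Carrier) → (∀ i j k → f i j k ≈ f j k i) →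
               sum₃ f ≈ sum (λ i → f i i i)
  sum-cyclic char {zero}  f cyc = trans (sum-[] _) (sym (sum-[] _))
  sum-cyclic char {suc n} f cyc = begin
    sum₃ f
      ≈⟨ sum-∷ _ ⟩
    sum₂ (f zero) + sum (λ i → sum₂ (f (suc i)))
      ≈⟨ +-cong (sum₂-∷ _) (trans (sum-cong (λ i → sum₂-∷ _)) (trans (sum-+ _ _) (+-congˡ (trans (sum-+ _ _) (+-congˡ (sum-+ _ _)))))) ⟩
    (f zero zero zero + (sum (λ k → f zero zero (suc k)) + (sum (λ j → f zero (suc j) zero) + sum₂ (λ j k → f zero (suc j) (suc k))))) +
    (sum (λ i → f (suc i) zero zero) + (sum₂ (λ i k → f (suc i) zero (suc k)) + (sum₂ (λ i j → f (suc i) (suc j) zero) +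
      sum₃ (λ i j k → f (suc i) (suc j) (suc k)))))
      ≈⟨ +-cong (+-congˡ (+-cong (sum-cong (λ k → cyc zero zero (suc k)))
                         (+-cong refl
                                 (sum-cong (λ j → sum-cong (λ k → cyc zero (suc j) (suc k)))))))
                (+-cong (sum-cong (λ i → trans (cyc (suc i) zero zero) (cyc zero zero (suc i))))
                (+-cong (trans (sum-cong (λ i → sum-cong (λ k → trans (cyc (suc i) zero (suc k)) (cyc zero (suc k) (suc i))))) (sum-swap _))
                        (+-congˡ (sum-cyclic char _ (λ i j k → cyc (suc i) (suc j) (suc k)))))) ⟩
    (f zero zero zero + (X + (X + Y))) + (X + (Y + (Y + Z)))
      ≈⟨ solve 4 (λ a x y z → (a :+ (x :+ (x :+ y))) :+ (x :+ (y :+ (y :+ z))) :=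
                              (a :+ z) :+ ((x :+ y) :+ ((x :+ y) :+ (x :+ y)))) refl _ X Y Z ⟩
    (f zero zero zero + Z) + ((X + Y) + ((X + Y) + (X + Y)))
      ≈⟨ trans (+-congˡ (char (X + Y))) (+-identityʳ _) ⟩
    f zero zero zero + Z
      ≈⟨ sum-∷ _ ⟨
    sum (λ i → f i i i) ∎
    where
    X = sum (λ k → f zero (suc k) zero)
    Y = sum₂ (λ j k → f (suc j) (suc k) zero)
    Z = sum (λ i → f (suc i) (suc i) (suc i))

module Matrices {c ℓ} (R : CommutativeRing c ℓ) where
  open CommutativeRing R hiding (zero)
  open Sums R
  open Frobenius R
  open Determinants R using (Rows; _≈ᵣ_)
  open IntegerCoefficients R using (solve; _:=_; _:*_)
  open Relation.Binary.Reasoning.Setoid setoid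

  infixl 7 _⊗_
  _⊗_ : ∀ {k l n} → Rows k l → Rows l n → Rows k n
  (A ⊗ B) i j = sum (λ l → A i l * B l j)

  infixl 6 _⊕_
  _⊕_ : ∀ {k n} → Rows k n → Rows k n → Rows k n
  (A ⊕ B) i j = A i j + B i j

  ⊕-char : ∀ e → HasCharacteristic e → ∀ {k n} (A : Rows k n) → power _⊕_ e A ≈ᵣ λ _ _ → 0#
  ⊕-char two   char A i j = char (A i j)
  ⊕-char three char A i j = char (A i j)

  ⊗-cong : ∀ {k l n} {A A′ : Rows k l} {B B′ : Rows l n} → A ≈ᵣ A′ → B ≈ᵣ B′ → A ⊗ B ≈ᵣ A′ ⊗ B′
  ⊗-cong A≈ B≈ i j = sum-cong (λ l → *-cong (A≈ i l) (B≈ l j))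

  ⊗-assoc : ∀ {k l m n} (A : Rows k l) (B : Rows l m) (C : Rows m n) → A ⊗ B ⊗ C ≈ᵣ A ⊗ (B ⊗ C)
  ⊗-assoc A B C i j = begin
    sum (λ b → sum (λ a → A i a * B a b) * C b j)    ≈⟨ sum-cong (λ b → sum-*ʳ _ _) ⟩
    sum (λ b → sum (λ a → A i a * B a b * C b j))    ≈⟨ sum-swap _ ⟩
    sum (λ a → sum (λ b → A i a * B a b * C b j))    ≈⟨ sum-cong (λ a → trans (sum-cong (λ b → *-assoc _ _ _)) (sym (sum-*ˡ _ _))) ⟩
    sum (λ a → A i a * sum (λ b → B a b * C b j))    ∎

  ⊗-identityˡ : ∀ {k n} (A : Rows k n) → δ ⊗ A ≈ᵣ A
  ⊗-identityˡ A i j = sum-δˡ i (λ l → A l j)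

  ⊗-identityʳ : ∀ {k n} (A : Rows k n) → A ⊗ δ ≈ᵣ A
  ⊗-identityʳ A i j = sum-δʳ j (A i)

  matrixRing : ℕ → Ring c ℓ
  matrixRing n = record
    { Carrier = Rows n n ; _≈_ = _≈ᵣ_ ; _+_ = _⊕_ ; _*_ = _⊗_ ; -_ = λ A i j → - A i j
    ; 0# = λ _ _ → 0# ; 1# = δ
    ; isRing = record
      { +-isAbelianGroup = Pointwise.isAbelianGroup _ (Pointwise.isAbelianGroup _ +-isAbelianGroup)
      ; *-cong     = ⊗-cong
      ; *-assoc    = ⊗-assoc
      ; *-identity = ⊗-identityˡ , ⊗-identityʳ
      ; distrib    = (λ A B C i j → trans (sum-cong (λ l → distribˡ _ _ _)) (sum-+ _ _)) ,
                     (λ A B C i j → trans (sum-cong (λ l → distribʳ _ _ _)) (sum-+ _ _))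
      }
    }

  tr : ∀ {n} → Rows n n → Carrier
  tr A = sum (λ i → A i i)

  tr-cong : ∀ {n} {A B : Rows n n} → A ≈ᵣ B → tr A ≈ tr B
  tr-cong A≈B = sum-cong (λ i → A≈B i i)

  tr-⊕ : ∀ {n} (A B : Rows n n) → tr (A ⊕ B) ≈ tr A + tr B
  tr-⊕ A B = sum-+ _ _

  tr-comm : ∀ {n} (A B : Rows n n) → tr (A ⊗ B) ≈ tr (B ⊗ A)
  tr-comm A B = trans (sum-swap _) (sum-cong (λ i → sum-cong (λ j → *-comm _ _)))

  -- In tr (Aᵖ), a sum over cyclic words of length p, only the constant words survive modulo p.
  tr-power : ∀ e → HasCharacteristic e → ∀ {n} (A : Rows n n) → tr (power _⊗_ e A) ≈ tr A ^ e
  tr-power two char A = begin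
    sum₂ (λ i j → A i j * A j i)      ≈⟨ sum-symmetric char _ (λ i j → *-comm _ _) ⟩
    sum (λ i → A i i * A i i)         ≈⟨ sum-symmetric char (λ i j → A i i * A j j) (λ i j → *-comm _ _) ⟨
    sum₂ (λ i j → A i i * A j j)      ≈⟨ sum-cong (λ i → sym (sum-*ˡ _ _)) ⟩
    sum (λ i → A i i * tr A)          ≈⟨ sum-*ʳ _ _ ⟨
    tr A * tr A                       ∎
  tr-power three char A = begin
    sum₂ (λ i j → A i j * sum (λ k → A j k * A k i))   ≈⟨ sum-cong (λ i → sum-cong (λ j → sum-*ˡ _ _)) ⟩
    sum₃ (λ i j k → A i j * (A j k * A k i))           ≈⟨ sum-cyclic char _ (λ i j k → rotate _ _ _) ⟩
    sum (λ i → A i i * (A i i * A i i))                ≈⟨ sum-cyclic char (λ i j k → A i i * (A j j * A k k)) (λ i j k → rotate _ _ _) ⟨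
    sum₃ (λ i j k → A i i * (A j j * A k k))           ≈⟨ sum-cong (λ i → trans (sum-cong (λ j → trans (sym (sum-*ˡ _ _)) (*-congˡ (sym (sum-*ˡ _ _))))) (sym (sum-*ˡ _ _))) ⟩
    sum (λ i → A i i * sum (λ j → A j j * sum (λ k → A k k)))
                                                       ≈⟨ sum-*ʳ _ _ ⟨
    tr A * sum (λ j → A j j * tr A)                    ≈⟨ *-congˡ (sum-*ʳ _ _) ⟨
    tr A * (tr A * tr A)                               ∎
    where
    rotate : ∀ x y z → x * (y * z) ≈ y * (z * x)
    rotate = solve 3 (λ x y z → x :* (y :* z) := y :* (z :* x)) refl

-- Commutators in characteristic p

-- The power of x with exponent p to the N. Like `power` it takes the operation as a parameter,
-- because it is compared between an algebra and its endomorphisms.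
frobenius : ∀ {a} {A : Set a} → (A → A → A) → Exponent → ℕ → A → A
frobenius _∙_ e zero    x = x
frobenius _∙_ e (suc N) x = power _∙_ e (frobenius _∙_ e N x)

module Commutators {c ℓ} (M : Ring c ℓ) where
  open Ring M hiding (zero)
  open Algebra.Properties.Ring M
  open Algebra.Solver.CommutativeMonoid +-commutativeMonoid using () renaming (solve to shuffle; _⊕_ to _⊞_; _⊜_ to _≐_)
  open Relation.Binary.Reasoning.Setoid setoid

  ad : Carrier → Carrier → Carrier
  ad x f = x * f - f * x

  ad-cong : ∀ {x y f g} → x ≈ y → f ≈ g → ad x f ≈ ad y g
  ad-cong x≈y f≈g = +-cong (*-cong x≈y f≈g) (-‿cong (*-cong f≈g x≈y))

  -- The two mixed terms are kept together as -2xfx, which vanishes in characteristic 2 and becomes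
  -- +xfx in characteristic 3.
  ad-ad : ∀ x f → ad x (ad x f) ≈ (x * (x * f) + f * x * x) + (- (x * (f * x)) - x * (f * x))
  ad-ad x f = begin
    x * (x * f - f * x) - (x * f - f * x) * x                          ≈⟨ +-cong (x[y-z]≈xy-xz _ _ _) (-‿cong (trans ([y-z]x≈yx-zx _ _ _) (+-congʳ (*-assoc _ _ _)))) ⟩
    (x * (x * f) - x * (f * x)) - (x * (f * x) - f * x * x)            ≈⟨ +-congˡ (⁻¹-anti-homo-// _ _) ⟩
    (x * (x * f) - x * (f * x)) + (f * x * x - x * (f * x))
      ≈⟨ shuffle 4 (λ a b c d → (a ⊞ b) ⊞ (c ⊞ d) ≐ (a ⊞ c) ⊞ (b ⊞ d)) refl _ _ _ _ ⟩
    (x * (x * f) + f * x * x) + (- (x * (f * x)) - x * (f * x))        ∎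

  ad-power-2 : (char : ∀ x → x + x ≈ 0#) → ∀ x f → ad x (ad x f) ≈ ad (x * x) f
  ad-power-2 char x f = begin
    ad x (ad x f)                                      ≈⟨ ad-ad x f ⟩
    (x * (x * f) + f * x * x) + (- b - b)              ≈⟨ trans (+-congˡ (char (- b))) (+-identityʳ _) ⟩
    x * (x * f) + f * x * x                            ≈⟨ +-cong (sym (*-assoc _ _ _)) (trans (*-assoc _ _ _) (+-inverseˡ-unique _ _ (char _))) ⟩
    x * x * f - f * (x * x)                            ∎
    where
    b = x * (f * x)

  -- In characteristic 3 the double commutator is x²f + xfx + fx², and one more commutator with x
  -- telescopes this to x³f - fx³.
  ad-power-3 : (char : ∀ x → x + (x + x) ≈ 0#) →  ∀ x f → ad x (ad x (ad x f)) ≈ ad (x * (x * x)) f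
  ad-power-3 char x f = begin
    ad x (ad x (ad x f))                               ≈⟨ ad-cong refl (trans (ad-ad x f) (+-congˡ -b-b≈b)) ⟩
    x * ((a + c′) + b) - ((a + c′) + b) * x            ≈⟨ +-cong (trans (distribˡ _ _ _) (+-congʳ (distribˡ _ _ _)))
                                                            (-‿cong (trans (distribʳ _ _ _) (+-congʳ (distribʳ _ _ _)))) ⟩
    ((x * a + x * c′) + x * b) - ((a * x + c′ * x) + b * x)
      ≈⟨ +-congˡ (-‿cong (+-cong (+-congʳ (trans (*-assoc _ _ _) (*-congˡ (*-assoc _ _ _)))) (*-assoc _ _ _))) ⟩
    ((x * a + x * c′) + x * b) - ((x * b + c′ * x) + x * c′)
      ≈⟨ +-congˡ (trans (-‿cong (shuffle 3 (λ p q r → (p ⊞ q) ⊞ r ≐ (r ⊞ p) ⊞ q) refl _ _ _)) (sym (-‿+-comm _ _))) ⟩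
    ((x * a + x * c′) + x * b) + (- (x * c′ + x * b) - c′ * x)
      ≈⟨ shuffle 5 (λ p q r s t → ((p ⊞ q) ⊞ r) ⊞ (s ⊞ t) ≐ (p ⊞ t) ⊞ ((q ⊞ r) ⊞ s)) refl _ _ _ _ _ ⟩
    (x * a - c′ * x) + ((x * c′ + x * b) - (x * c′ + x * b))
      ≈⟨ trans (+-congˡ (-‿inverseʳ _)) (+-identityʳ _) ⟩
    x * a - c′ * x
      ≈⟨ +-cong (trans (*-congˡ (sym (*-assoc _ _ _))) (sym (*-assoc _ _ _))) (-‿cong (trans (*-assoc _ _ _) (*-assoc _ _ _))) ⟩
    x * (x * x) * f - f * (x * (x * x))                ∎
    where
    a = x * (x * f)
    b = x * (f * x)
    c′ = f * x * x
    -b-b≈b : - b - b ≈ b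
    -b-b≈b = trans (-‿+-comm b b) (sym (+-inverseˡ-unique _ _ (char b)))

  Commute : Carrier → Carrier → Set ℓ
  Commute x y = x * y ≈ y * x

  commute-* : ∀ {z x y} → Commute z x → Commute z y → Commute z (x * y)
  commute-* {z} {x} {y} zx zy = begin
    z * (x * y)  ≈⟨ trans (sym (*-assoc _ _ _)) (*-congʳ zx) ⟩
    x * z * y    ≈⟨ trans (*-assoc _ _ _) (*-congˡ zy) ⟩
    x * (y * z)  ≈⟨ *-assoc _ _ _ ⟨
    x * y * z    ∎

  commute-- : ∀ {z x y} → Commute z x → Commute z y → Commute z (x - y)
  commute-- zx zy = trans (x[y-z]≈xy-xz _ _ _) (trans (+-cong zx (-‿cong zy)) (sym ([y-z]x≈yx-zx _ _ _)))

  commute-ad : ∀ {z x f} → Commute z x → Commute z f → Commute z (ad x f)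
  commute-ad zx zf = commute-- (commute-* zx zf) (commute-* zf zx)

  commute-power : ∀ e {z x} → Commute z x → Commute z (power _*_ e x)
  commute-power two   zx = commute-* zx zx
  commute-power three zx = commute-* zx (commute-* zx zx)

  -- Here h is (ad x) to the p - 2 applied to f. Two outer commutators are split off because the
  -- projection onto the centraliser subtracts `ad x h` and then needs one more `ad x`. The last
  -- component lets elements commuting with x and f survive the projection.
  ad-power : ∀ e → (∀ x → power _+_ e x ≈ 0#) → ∀ x f →
             ∃[ h ] (ad (power _*_ e x) f ≈ ad x (ad x h) × (∀ z → Commute z x → Commute z f → Commute z h))
  ad-power two   char x f = f , sym (ad-power-2 char x f) , λ z zx zf → zf
  ad-power three char x f = ad x f , sym (ad-power-3 char x f) , λ z zx zf → commute-ad zx zf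

  module _ (e : Exponent) (char : ∀ x → power _+_ e x ≈ 0#) where

    ad-frobenius : ∀ x N → (∀ z → Commute z x → Commute z (frobenius _*_ e (suc N) x)) × (∀ f →
                   ∃[ h ] (ad (frobenius _*_ e (suc N) x) f ≈ ad x (ad x h) × (∀ z → Commute z x → Commute z f → Commute z h)))
    ad-frobenius x zero    = (λ z → commute-power e) , ad-power e char x
    ad-frobenius x (suc N) with ad-frobenius x N
    ... | commute-y , ad-y = (λ z zx → commute-power e (commute-y z zx)) , λ f →
      let y                      = frobenius _*_ e (suc N) x
          h , ad≈ , commute-h    = ad-power e char y f
          -- The commutator of yᵖ with f is `ad y (ad y h)`; its outer `ad y` is resolved by the
          -- previous stage, applied to `ad y h`. In the end h′ is (ad x) to the q - 2 applied to f.
          h′ , ad≈′ , commute-h′ = ad-y (ad y h)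
      in h′ , trans ad≈ ad≈′ , λ z zx zf → commute-h′ z zx (commute-ad (commute-y z zx) (commute-h z (commute-y z zx) zf))

    -- If x equals its q-th power, q = eᴺ⁺¹, then ad x and (ad x)^q agree, so f ↦ f - (ad x)^(q-1) f maps into the centraliser of x.
    centralise : ∀ x N → frobenius _*_ e (suc N) x ≈ x → ∀ f →
                 ∃[ h ] (Commute x (f - ad x h) × (∀ z → Commute z x → Commute z f → Commute z (f - ad x h)))
    centralise x N xᵠ≈x f with proj₂ (ad-frobenius x N) f
    ... | h , ad≈ , commute-h = h , x∙y⁻¹≈ε⇒x≈y _ _ (begin
      ad x (f - ad x h)                  ≈⟨ +-cong (x[y-z]≈xy-xz _ _ _) (-‿cong ([y-z]x≈yx-zx _ _ _)) ⟩
      (x * f - x * g) - (f * x - g * x)  ≈⟨ +-congˡ (⁻¹-anti-homo-// _ _) ⟩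
      (x * f - x * g) + (g * x - f * x)  ≈⟨ shuffle 4 (λ p q r s → (p ⊞ q) ⊞ (r ⊞ s) ≐ (p ⊞ s) ⊞ (r ⊞ q)) refl _ _ _ _ ⟩
      ad x f + (g * x - x * g)           ≈⟨ +-congˡ (⁻¹-anti-homo-// _ _) ⟨
      ad x f - ad x g                    ≈⟨ +-congʳ (trans (ad-cong (sym xᵠ≈x) refl) ad≈) ⟩
      ad x g - ad x g                    ≈⟨ -‿inverseʳ _ ⟩
      0#                                 ∎) , λ z zx zf → commute-- zf (commute-ad zx (commute-h z zx zf))
      where g = ad x h

    -- Since the x i commute with one another, the correction for one of them keeps commutation with
    -- those already treated. `P` stands for whatever subtracting commutators with the x i
    -- preserves; below it fixes the trace pairings.
    centralise-all : ∀ {p} (P : Carrier → Set p) {m} (x : Fin m → Carrier) → (∀ i → ∃[ N ] frobenius _*_ e (suc N) (x i) ≈ x i) →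
                     (∀ i j → Commute (x i) (x j)) → (∀ i f h → P f → P (f - ad (x i) h)) →
                     ∀ f → P f → ∃[ g ] (P g × (∀ i → Commute (x i) g))
    centralise-all P {zero}  x periodic commute P-ad f Pf = f , Pf , λ ()
    centralise-all P {suc m} x periodic commute P-ad f Pf
      with centralise-all P (x ∘ suc) (periodic ∘ suc) (λ i j → commute (suc i) (suc j)) (P-ad ∘ suc) f Pf
    ... | g , Pg , commute-g with centralise (x zero) (proj₁ (periodic zero)) (proj₂ (periodic zero)) g
    ... | h , commute₀ , commute-h = g - ad (x zero) h , P-ad zero g h Pg ,
      λ { zero → commute₀ ; (suc i) → commute-h (x (suc i)) (commute (suc i) zero) (commute-g i) }

-- Algebras given by structure constants

module StructureConstants {c ℓ} (F : CommutativeRing c ℓ) {m} (sc : Fin m → Fin m → Fin m → CommutativeRing.Carrier F) where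
  open CommutativeRing F hiding (zero)
  open Sums F
  open Determinants F
  open AlternatingForms F using (cramer)
  open DeterminantProduct F using (det-*; det-δ)
  open Frobenius F
  open Matrices F
  open IntegerCoefficients F using (solve; _:=_; _:+_; _:*_)
  open Algebra.Properties.Ring ring
  open Relation.Binary.Reasoning.Setoid setoid

  Vec : Set c
  Vec = Fin m → Carrier

  infix 4 _≋_
  _≋_ : Vec → Vec → Set ℓ
  x ≋ y = ∀ k → x k ≈ y k

  infixl 7 _⋆_
  _⋆_ : Vec → Vec → Vec
  (x ⋆ y) k = sum (λ i → sum (λ j → x i * (y j * sc i j k)))

  ⋆-cong : ∀ {x x′ y y′} → x ≋ x′ → y ≋ y′ → x ⋆ y ≋ x′ ⋆ y′
  ⋆-cong x≋ y≋ k = sum-cong (λ i → sum-cong (λ j → *-cong (x≋ i) (*-congʳ (y≋ j))))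

  L : Vec → Rows m m
  L x k j = (x ⋆ δ j) k

  δ⋆ : ∀ i y k → (δ i ⋆ y) k ≈ sum (λ j → y j * sc i j k)
  δ⋆ i y k = trans (sum-cong (λ _ → sym (sum-*ˡ _ _))) (sum-δˡ i _)

  ⋆δ : ∀ x j k → L x k j ≈ sum (λ i → x i * sc i j k)
  ⋆δ x j k = sum-cong (λ i → trans (sym (sum-*ˡ _ _)) (*-congˡ (sum-δˡ j (λ j → sc i j k))))

  ⋆-expandˡ : ∀ x y k → (x ⋆ y) k ≈ sum (λ i → x i * (δ i ⋆ y) k)
  ⋆-expandˡ x y k = sum-cong (λ i → trans (sym (sum-*ˡ _ _)) (*-congˡ (sym (δ⋆ i y k))))

  ⋆-expandʳ : ∀ x y k → (x ⋆ y) k ≈ sum (λ j → L x k j * y j)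
  ⋆-expandʳ x y k = begin
    sum (λ i → sum (λ j → x i * (y j * sc i j k)))   ≈⟨ sum-swap _ ⟩
    sum (λ j → sum (λ i → x i * (y j * sc i j k)))   ≈⟨ sum-cong (λ j → trans (sum-cong (λ i →
                                                          solve 3 (λ x y s → x :* (y :* s) := x :* s :* y) refl (x i) (y j) (sc i j k))) (sym (sum-*ʳ _ _))) ⟩
    sum (λ j → sum (λ i → x i * sc i j k) * y j)     ≈⟨ sum-cong (λ j → *-congʳ (⋆δ x j k)) ⟨
    sum (λ j → L x k j * y j)                        ∎

  trace : Vec → Carrier
  trace x = tr (L x)

  traceForm : Rows m m
  traceForm i j = trace (δ i ⋆ δ j)

  trace-cong : ∀ {x y} → x ≋ y → trace x ≈ trace y
  trace-cong x≋y = tr-cong (λ k j → ⋆-cong {y = δ j} {δ j} x≋y (λ _ → refl) k)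

  trace-expand : ∀ x → trace x ≈ sum (λ l → x l * trace (δ l))
  trace-expand x = begin
    sum (λ k → L x k k)                            ≈⟨ sum-cong (λ k → ⋆-expandˡ x (δ k) k) ⟩
    sum (λ k → sum (λ l → x l * L (δ l) k k))      ≈⟨ sum-swap _ ⟩
    sum (λ l → sum (λ k → x l * L (δ l) k k))      ≈⟨ sum-cong (λ l → sym (sum-*ˡ _ _)) ⟩
    sum (λ l → x l * trace (δ l))                  ∎

  trace-⋆ : ∀ x y → trace (x ⋆ y) ≈ sum (λ i → x i * trace (δ i ⋆ y))
  trace-⋆ x y = begin
    trace (x ⋆ y)                                                      ≈⟨ trace-expand _ ⟩
    sum (λ l → (x ⋆ y) l * trace (δ l))                                ≈⟨ sum-cong (λ l → trans (*-congʳ (⋆-expandˡ x y l)) (sum-*ʳ _ _)) ⟩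
    sum (λ l → sum (λ i → x i * (δ i ⋆ y) l * trace (δ l)))            ≈⟨ sum-swap _ ⟩
    sum (λ i → sum (λ l → x i * (δ i ⋆ y) l * trace (δ l)))            ≈⟨ sum-cong (λ i → trans (sum-cong (λ l → *-assoc _ _ _))
                                                                            (trans (sym (sum-*ˡ _ _)) (*-congˡ (sym (trace-expand _))))) ⟩
    sum (λ i → x i * trace (δ i ⋆ y))                                  ∎

  -- By linearity, x in the radical is a relation between the rows of the Gram matrix, and Cramer's
  -- rule applies to its coefficients.
  trace-nondegenerate : ∀ x → (∀ y → trace (x ⋆ y) ≈ 0#) → ∀ j → x j * det traceForm ≈ 0#
  trace-nondegenerate x tr≈0 = cramer traceForm x (λ j → trans (sym (trace-⋆ x (δ j))) (tr≈0 (δ j)))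

  record IsCommutativeAlgebra (one : Vec) : Set (c Level.⊔ ℓ) where
    field
      ⋆-comm      : ∀ x y → x ⋆ y ≋ y ⋆ x
      ⋆-assoc     : ∀ x y z → x ⋆ y ⋆ z ≋ x ⋆ (y ⋆ z)
      ⋆-identityˡ : ∀ x → one ⋆ x ≋ x

    algebra : CommutativeRing c ℓ
    algebra = record
      { Carrier = Vec ; _≈_ = _≋_ ; _+_ = λ x y k → x k + y k ; _*_ = _⋆_ ; -_ = λ x k → - x k
      ; 0# = λ _ → 0# ; 1# = one
      ; isCommutativeRing = record
        { isRing = record
          { +-isAbelianGroup = Pointwise.isAbelianGroup _ +-isAbelianGroup
          ; *-cong     = ⋆-cong
          ; *-assoc    = ⋆-assoc
          ; *-identity = ⋆-identityˡ , λ x k → trans (⋆-comm x one k) (⋆-identityˡ x k)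
          ; distrib    = ⋆-distribˡ , λ x y z k → trans (⋆-comm _ x k) (trans (⋆-distribˡ x y z k) (+-cong (⋆-comm x y k) (⋆-comm x z k)))
          }
        ; *-comm = ⋆-comm
        }
      }
      where
      ⋆-distribˡ : ∀ x y z k → (x ⋆ (λ k → y k + z k)) k ≈ (x ⋆ y) k + (x ⋆ z) k
      ⋆-distribˡ x y z k = trans (sum-cong (λ i → trans (sum-cong (λ j →
        solve 4 (λ x y z s → x :* ((y :+ z) :* s) := x :* (y :* s) :+ x :* (z :* s)) refl (x i) (y j) (z j) (sc i j k))) (sum-+ _ _))) (sum-+ _ _)

    module A = CommutativeRing algebra
    open Frobenius algebra using () renaming (_^_ to _⋆^_)

    L-⋆ : ∀ x y → L (x ⋆ y) ≈ᵣ L x ⊗ L y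
    L-⋆ x y k j = trans (⋆-assoc x y (δ j) k) (⋆-expandʳ x (y ⋆ δ j) k)

    L-cong : ∀ {x y} → x ≋ y → L x ≈ᵣ L y
    L-cong x≋y k j = ⋆-cong {y = δ j} {δ j} x≋y (λ _ → refl) k

    L-power : ∀ e x {X} → L x ≈ᵣ X → L (x ⋆^ e) ≈ᵣ power _⊗_ e X
    L-power two   x L≈X k j = trans (L-⋆ x x k j) (⊗-cong L≈X L≈X k j)
    L-power three x L≈X k j = trans (L-⋆ x (x ⋆ x) k j)
      (⊗-cong L≈X (λ k j → trans (L-⋆ x x k j) (⊗-cong L≈X L≈X k j)) k j)

    L-frobenius : ∀ e N x → L (frobenius _⋆_ e N x) ≈ᵣ frobenius _⊗_ e N (L x)
    L-frobenius e zero    x k j = refl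
    L-frobenius e (suc N) x = L-power e (frobenius _⋆_ e N x) (L-frobenius e N x)

    trace-power : ∀ e → HasCharacteristic e → ∀ x → trace (x ⋆^ e) ≈ trace x ^ e
    trace-power e char x = trans (tr-cong (L-power e x (λ _ _ → refl))) (tr-power e char (L x))

    module _ (e : Exponent) (char : HasCharacteristic e)
             (periodic : ∀ i → ∃[ N ] frobenius _⋆_ e (suc N) (δ i) ≋ δ i) where

      open Commutators (matrixRing m) using (ad; Commute; centralise-all)
      private module M = Ring (matrixRing m)

      L-commute : ∀ x y → Commute (L x) (L y)
      L-commute x y = M.trans (M.sym (L-⋆ x y)) (M.trans (L-cong (⋆-comm x y)) (L-⋆ y x))

      -- An endomorphism commuting with all multiplications is multiplication by its value at 1,
      -- because g (y 1) = y g (1). The one-column matrix `col` holds the unit, so that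
      -- associativity of matrix products covers application to a vector.
      commutant : ∀ (g : Rows m m) → (∀ i → Commute (L (δ i)) g) → g ≈ᵣ L (λ k → sum (λ l → g k l * one l))
      commutant g commute k j = begin
        g k j                              ≈⟨ sum-δʳ j (g k) ⟨
        sum (λ l → g k l * δ l j)          ≈⟨ sum-cong (λ l → *-congˡ (trans (δ-comm l j)
                                               (trans (sym (A.*-identityʳ (δ j) l)) (⋆-expandʳ (δ j) one l)))) ⟩
        (g ⊗ (L (δ j) ⊗ col)) k zero       ≈⟨ ⊗-assoc g (L (δ j)) col k zero ⟨
        (g ⊗ L (δ j) ⊗ col) k zero         ≈⟨ ⊗-cong {B = col} (M.sym (commute j)) (λ _ _ → refl) k zero ⟩
        (L (δ j) ⊗ g ⊗ col) k zero         ≈⟨ ⊗-assoc (L (δ j)) g col k zero ⟩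
        (L (δ j) ⊗ (g ⊗ col)) k zero       ≈⟨ ⋆-expandʳ (δ j) u k ⟨
        (δ j ⋆ u) k                        ≈⟨ ⋆-comm (δ j) u k ⟩
        L u k j                            ∎
        where
        u : Vec
        u k = sum (λ l → g k l * one l)
        col : Rows m 1
        col l _ = one l

      -- By cyclicity the trace of XhY is that of hYX, and YX = XY in a commutative algebra. Hence
      -- subtracting commutators leaves all pairings with multiplications unchanged.
      tr-ad : ∀ x y h → tr (ad (L x) h ⊗ L y) ≈ 0#
      tr-ad x y h = begin
        tr ((X ⊗ h M.- h ⊗ X) ⊗ Y)              ≈⟨ tr-cong ([y-z]x≈yx-zx′ Y (X ⊗ h) (h ⊗ X)) ⟩
        tr (X ⊗ h ⊗ Y M.- h ⊗ X ⊗ Y)            ≈⟨ trans (sum-+ _ _) (+-congˡ (sum-neg _)) ⟩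
        tr (X ⊗ h ⊗ Y) - tr (h ⊗ X ⊗ Y)         ≈⟨ +-congʳ (trans (tr-cong (⊗-assoc X h Y)) (trans (tr-comm X (h ⊗ Y)) (tr-cong
                                                     (M.trans (⊗-assoc h Y X) (M.trans (⊗-cong (λ _ _ → refl) (L-commute y x)) (M.sym (⊗-assoc h X Y))))))) ⟩
        tr (h ⊗ X ⊗ Y) - tr (h ⊗ X ⊗ Y)         ≈⟨ -‿inverseʳ _ ⟩
        0#                                      ∎
        where
        X = L x
        Y = L y
        open Algebra.Properties.Ring (matrixRing m) using () renaming ([y-z]x≈yx-zx to [y-z]x≈yx-zx′)

      -- Every functional φ is trace (u ⋆ -): the endomorphism z ↦ φ(z) 1 can be replaced by one commuting
      -- with all multiplications, that is by a multiplication, without changing its trace pairings.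
      dual : ∀ (φ : Vec) → ∃[ u ] (∀ j → sum (λ i → u i * traceForm i j) ≈ φ j)
      dual φ with centralise-all e (⊕-char e char) P (L ∘ δ) periodic′ (λ i j → L-commute (δ i) (δ j)) P-ad f Pf
        where
        P : Rows m m → Set ℓ
        P g = ∀ j → tr (g ⊗ L (δ j)) ≈ φ j
        f : Rows m m
        f k l = one k * φ l
        periodic′ : ∀ i → ∃[ N ] frobenius _⊗_ e (suc N) (L (δ i)) ≈ᵣ L (δ i)
        periodic′ i = proj₁ (periodic i) , M.trans (M.sym (L-frobenius e (suc (proj₁ (periodic i))) (δ i))) (L-cong (proj₂ (periodic i)))
        Pf : P f
        Pf j = begin
          tr (f ⊗ L (δ j))                                           ≈⟨ sum-cong (λ k → sum-cong (λ l →
                                                                          solve 3 (λ o p x → o :* p :* x := p :* (x :* o)) refl (one k) (φ l) _)) ⟩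
          sum (λ k → sum (λ l → φ l * (L (δ j) l k * one k)))        ≈⟨ sum-swap _ ⟩
          sum (λ l → sum (λ k → φ l * (L (δ j) l k * one k)))        ≈⟨ sum-cong (λ l → trans (sym (sum-*ˡ _ _)) (*-congˡ
                                                                          (trans (sym (⋆-expandʳ (δ j) one l)) (A.*-identityʳ (δ j) l)))) ⟩
          sum (λ l → φ l * δ j l)                                    ≈⟨ trans (sum-cong (λ l → *-congˡ (δ-comm j l))) (sum-δʳ j φ) ⟩
          φ j                                                        ∎
        P-ad : ∀ i g h → P g → P (g M.- ad (L (δ i)) h)
        P-ad i g h Pg j = begin
          tr ((g M.- ad (L (δ i)) h) ⊗ L (δ j))                      ≈⟨ tr-cong ([y-z]x≈yx-zx′ (L (δ j)) g (ad (L (δ i)) h)) ⟩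
          tr (g ⊗ L (δ j) M.- ad (L (δ i)) h ⊗ L (δ j))              ≈⟨ trans (sum-+ _ _) (+-congˡ (sum-neg _)) ⟩
          tr (g ⊗ L (δ j)) - tr (ad (L (δ i)) h ⊗ L (δ j))           ≈⟨ +-cong (Pg j) (trans (-‿cong (tr-ad (δ i) (δ j) h)) -0#≈0#) ⟩
          φ j + 0#                                                   ≈⟨ +-identityʳ _ ⟩
          φ j                                                        ∎
          where open Algebra.Properties.Ring (matrixRing m) using () renaming ([y-z]x≈yx-zx to [y-z]x≈yx-zx′)
      ... | g , Pg , commute = u , λ j → begin
        sum (λ i → u i * traceForm i j)     ≈⟨ trace-⋆ u (δ j) ⟨
        trace (u ⋆ δ j)                     ≈⟨ tr-cong (M.trans (L-⋆ u (δ j)) (⊗-cong (M.sym (commutant g commute)) (λ _ _ → refl))) ⟩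
        tr (g ⊗ L (δ j))                    ≈⟨ Pg j ⟩
        φ j                                 ∎
        where
        u : Vec
        u k = sum (λ l → g k l * one l)

      -- The elements dual to the coordinate functionals, taken as rows, form a left inverse of the
      -- Gram matrix, so its determinant is invertible by multiplicativity.
      det-traceForm-unit : ∃[ d ] d * det traceForm ≈ 1#
      det-traceForm-unit = det U , (begin
        det U * det traceForm   ≈⟨ det-* U traceForm ⟨
        det (U ⊗ traceForm)     ≈⟨ det-cong (λ i → proj₂ (dual (δ i))) ⟩
        det (δ {m})             ≈⟨ det-δ m ⟩
        1#                      ∎)
        where
        U : Rows m m
        U i = proj₁ (dual (δ i))

    ^-injective₀ : ∀ e → HasCharacteristic e → (∀ a → a ^ e ≈ 0# → a ≈ 0#) → (d : Carrier) → det traceForm * d ≈ 1# →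
                   ∀ x → x ⋆^ e ≋ A.0# → x ≋ A.0#
    ^-injective₀ e char reduced d unit x xᵉ≈0 k = begin
      x k                          ≈⟨ *-identityʳ _ ⟨
      x k * 1#                     ≈⟨ *-congˡ unit ⟨
      x k * (det traceForm * d)    ≈⟨ *-assoc _ _ _ ⟨
      x k * det traceForm * d      ≈⟨ *-congʳ (trace-nondegenerate x tr≈0 k) ⟩
      0# * d                       ≈⟨ zeroˡ d ⟩
      0#                           ∎
      where
      tr≈0 : ∀ y → trace (x ⋆ y) ≈ 0#
      tr≈0 y = reduced _ (begin
        trace (x ⋆ y) ^ e          ≈⟨ trace-power e char _ ⟨
        trace ((x ⋆ y) ⋆^ e)       ≈⟨ trace-cong (A.trans (Frobenius.^-distrib-* algebra e x y) (A.trans (A.*-congʳ xᵉ≈0) (A.zeroˡ _))) ⟩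
        trace A.0#                 ≈⟨ trans (trace-expand _) (sum-zero (λ l → zeroˡ _)) ⟩
        0#                         ∎)

-- The determinant of the statement

Σℤ≡fold : ∀ {k} (f : Fin k → ℤ) → Σℤ f ≡ fold ℤ._+_ (+ 0) f
Σℤ≡fold {zero}  f = ≡.sym (fold-[] ℤ._+_ (+ 0) f)
Σℤ≡fold {suc k} f = ≡.trans (≡.cong (λ s → f zero ℤ.+ s) (Σℤ≡fold (f ∘ suc))) (≡.sym (fold-∷ ℤ._+_ (+ 0) f))

Σℤ-cong : ∀ {k} {f g : Fin k → ℤ} → (∀ i → f i ≡ g i) → Σℤ f ≡ Σℤ g
Σℤ-cong {zero}  f≡g = ≡.refl
Σℤ-cong {suc k} f≡g = ≡.cong₂ ℤ._+_ (f≡g zero) (Σℤ-cong (f≡g ∘ suc))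

signℤ : ∀ {l} → Fin l → ℤ
signℤ zero    = + 1
signℤ (suc j) = ℤ.- signℤ j

cofactor : ∀ {k} → (Fin (suc k) → Fin (suc k) → ℤ) → Fin (suc k) → ℤ
cofactor A j = A zero j ℤ.* Defs.det (λ r c → A (suc r) (punchIn j c))

-- The sign function of Defs.det is local to its clause for a given k and matrix, so it is named here by metavariables,
-- which the clauses of this block solve in turn. Its index l is only decoupled from k once two columns have been
-- split off (l = k for a matrix of size 2 + k), and abstracting suc k needs a matrix given for all sizes at once.
mutual
  det-expand∞ : ∀ k (A : ∀ n → Fin n → Fin n → ℤ) → Defs.det (A (suc k)) ≡ Σℤ (λ j → signℤ j ℤ.* cofactor (A (suc k)) j)
  det-expand∞ zero    A = ≡.refl
  det-expand∞ (suc k) A = ≡.cong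
    (λ s → + 1 ℤ.* cofactor (A (suc (suc k))) zero ℤ.+ (-[1+ 0 ] ℤ.* cofactor (A (suc (suc k))) (suc zero) ℤ.+ s)) (tail-terms k A)

  tail-terms : ∀ k (A : ∀ n → Fin n → Fin n → ℤ) → _ ≡ Σℤ {k} (λ i → signℤ (suc (suc i)) ℤ.* cofactor (A (suc (suc k))) (suc (suc i)))
  tail-terms k A = Σℤ-cong (tail-term k A)

  tail-term : ∀ k (A : ∀ n → Fin n → Fin n → ℤ) i → _ ≡ signℤ (suc (suc i)) ℤ.* cofactor (A (suc (suc k))) (suc (suc i))
  tail-term k A i with cofactor (A (suc (suc k))) (suc (suc i))
  ... | t with suc k
  ...   | n = scaled-sign n A i t

  scaled-sign : ∀ n (A : ∀ n → Fin n → Fin n → ℤ) {l} (i : Fin l) t → _ ≡ signℤ (suc (suc i)) ℤ.* t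
  scaled-sign n A i t with ℤ.-_
  ... | neg = ≡.cong (λ s → neg (neg s) ℤ.* t) (local-sign n A i)

  local-sign : ∀ n (A : ∀ n → Fin n → Fin n → ℤ) {l} (i : Fin l) → _ ≡ signℤ i
  local-sign n A zero    = ≡.refl
  local-sign n A (suc i) = ≡.cong ℤ.-_ (local-sign n A i)

-- The block above works with a matrix for every size at once, so A is placed in a family that is
-- zero in all other sizes. Irrelevance of equality on ℕ removes the transport at its own size.
det-expand : ∀ {k} (A : Fin (suc k) → Fin (suc k) → ℤ) → Defs.det A ≡ Σℤ (λ j → signℤ j ℤ.* cofactor A j)
det-expand {k} A = ≡.subst (λ X → Defs.det X ≡ Σℤ (λ j → signℤ j ℤ.* cofactor X j)) family-at (det-expand∞ k family)
  where
  family : ∀ n → Fin n → Fin n → ℤ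
  family n with n ℕₚ.≟ suc k
  ... | yes n≡ = ≡.subst (λ n → Fin n → Fin n → ℤ) (≡.sym n≡) A
  ... | no  _  = λ _ _ → + 0
  family-at : family (suc k) ≡ A
  family-at with suc k ℕₚ.≟ suc k
  ... | no k≢k = ⊥-elim (k≢k ≡.refl)
  ... | yes k≡k with ℕₚ.≡-irrelevant k≡k ≡.refl
  ...   | ≡.refl = ≡.refl

-- Finite rings of prime characteristic

module IterateFrobenius {c ℓ} (R : CommutativeRing c ℓ) (e : Exponent) where
  open CommutativeRing R hiding (zero)
  open Frobenius R
  open Relation.Binary.Reasoning.Setoid setoid

  -- Finiteness in the form in which it is used: every sequence repeats a value. Writing the later
  -- index as `suc d ℕ.+ a` makes the period positive.
  Finite : Set _
  Finite = ∀ (s : ℕ → Carrier) → ∃[ a ] ∃[ d ] s a ≈ s (suc d ℕ.+ a)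

  φ : ℕ → Carrier → Carrier
  φ = frobenius _*_ e

  φ-cong : ∀ n {x y} → x ≈ y → φ n x ≈ φ n y
  φ-cong zero    x≈y = x≈y
  φ-cong (suc n) x≈y = ^-cong e (φ-cong n x≈y)

  φ-+ : ∀ m n x → φ (m ℕ.+ n) x ≈ φ m (φ n x)
  φ-+ zero    n x = refl
  φ-+ (suc m) n x = ^-cong e (φ-+ m n x)

  roots : (∀ x → ∃[ y ] y ^ e ≈ x) → Carrier → ℕ → Carrier
  roots root x zero    = x
  roots root x (suc n) = proj₁ (root (roots root x n))

  -- The chain of successive roots of x repeats, say at a and at a + d + 1. Raising the repeated
  -- element a + d + 1 times gives x from its later position, and x raised d + 1 times from its
  -- earlier one.
  surjective⇒periodic : Finite → (∀ x → ∃[ y ] y ^ e ≈ x) → ∀ x → ∃[ d ] φ (suc d) x ≈ x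
  surjective⇒periodic finite root x with finite (roots root x)
  ... | a , d , sₐ≈ = d , (begin
    φ (suc d) x                            ≈⟨ φ-cong (suc d) (φ-roots a) ⟨
    φ (suc d) (φ a (s a))                  ≈⟨ φ-+ (suc d) a (s a) ⟨
    φ (suc d ℕ.+ a) (s a)                  ≈⟨ φ-cong (suc d ℕ.+ a) sₐ≈ ⟩
    φ (suc d ℕ.+ a) (s (suc d ℕ.+ a))      ≈⟨ φ-roots (suc d ℕ.+ a) ⟩
    x                                      ∎)
    where
    s : ℕ → Carrier
    s = roots root x
    φ-suc : ∀ n y → φ (suc n) y ≈ φ n (y ^ e)
    φ-suc zero    y = refl
    φ-suc (suc n) y = ^-cong e (φ-suc n y)
    φ-roots : ∀ n → φ n (s n) ≈ x
    φ-roots zero    = refl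
    φ-roots (suc n) = trans (φ-suc n _) (trans (φ-cong n (proj₂ (root (s n)))) (φ-roots n))

  -- The iterated powers of x repeat, and injectivity cancels the first a steps, so x is its own
  -- power after d + 1 steps. Stopping one step earlier gives the root.
  injective⇒surjective : Finite → (∀ x y → x ^ e ≈ y ^ e → x ≈ y) → ∀ x → ∃[ y ] y ^ e ≈ x
  injective⇒surjective finite injective x with finite (λ n → φ n x)
  ... | a , d , φₐ≈ = φ d x , sym (cancel a (trans φₐ≈ (trans (reflexive (≡.cong (λ n → φ n x) (ℕₚ.+-comm (suc d) a))) (φ-+ a (suc d) x))))
    where
    cancel : ∀ n {y z} → φ n y ≈ φ n z → y ≈ z
    cancel zero    y≈z = y≈z
    cancel (suc n) y≈z = cancel n (injective _ _ y≈z)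

  kernel-trivial⇒injective : HasCharacteristic e → (∀ x → x ^ e ≈ 0# → x ≈ 0#) → ∀ x y → x ^ e ≈ y ^ e → x ≈ y
  kernel-trivial⇒injective char trivial x y xᵉ≈yᵉ = x∙y⁻¹≈ε⇒x≈y x y (trivial (x - y) (begin
    (x - y) ^ e          ≈⟨ ^-+ e char x (- y) ⟩
    x ^ e + (- y) ^ e    ≈⟨ +-congʳ xᵉ≈yᵉ ⟩
    y ^ e + (- y) ^ e    ≈⟨ ^-+ e char y (- y) ⟨
    (y - y) ^ e          ≈⟨ ^-cong e (-‿inverseʳ y) ⟩
    0# ^ e               ≈⟨ 0^ e ⟩
    0#                   ∎))
    where open Algebra.Properties.Ring ring

-- The integers modulo 2 and modulo 3

prime : Exponent → ℕ
prime two   = 2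
prime three = 3

module Modulo (p : ℤ) where
  open IntegerCoefficients ℤₚ.+-*-commutativeRing using (solve; _:=_; _:+_; _:*_; _:-_; :-_; con)

  infix 4 _≈_
  infix 3 _by_
  -- Congruence as an equality on ℤ itself: reduction modulo p is then the identity on
  -- representatives. The quotient is kept as data because lifting from 𝒪/p to 𝒪 reads it off.
  record _≈_ (a b : ℤ) : Set where
    constructor _by_
    field
      quotient : ℤ
      equation : a ≡ b ℤ.+ p ℤ.* quotient

  ≡⇒≈ : ∀ {a b} → a ≡ b → a ≈ b
  ≡⇒≈ {a} ≡.refl = + 0 by solve 2 (λ a p → a := a :+ p :* con (+ 0)) ≡.refl a p

  ≈-isEquivalence : IsEquivalence _≈_
  ≈-isEquivalence = record
    { refl  = ≡⇒≈ ≡.refl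
    ; sym   = λ { {_} {b} (w by ≡.refl) → ℤ.- w by solve 3 (λ b p w → b := b :+ p :* w :+ p :* (:- w)) ≡.refl b p w }
    ; trans = λ { {_} {_} {c} (w by ≡.refl) (v by ≡.refl) → (v ℤ.+ w) by solve 4 (λ c p v w → c :+ p :* v :+ p :* w := c :+ p :* (v :+ w)) ≡.refl c p v w }
    }

  ring : CommutativeRing _ _
  ring = record
    { Carrier = ℤ ; _≈_ = _≈_ ; _+_ = ℤ._+_ ; _*_ = ℤ._*_ ; -_ = ℤ.-_ ; 0# = + 0 ; 1# = + 1
    ; isCommutativeRing = record
      { isRing = record
        { +-isAbelianGroup = record
          { isGroup = record
            { isMonoid = record
              { isSemigroup = record
                { isMagma = record
                  { isEquivalence = ≈-isEquivalence
                  ; ∙-cong = λ { {_} {b} {_} {d} (w by ≡.refl) (v by ≡.refl) → (w ℤ.+ v) by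
                      solve 5 (λ b d p w v → (b :+ p :* w) :+ (d :+ p :* v) := (b :+ d) :+ p :* (w :+ v)) ≡.refl b d p w v } }
                ; assoc = λ a b c → ≡⇒≈ (ℤₚ.+-assoc a b c) }
              ; identity = (λ a → ≡⇒≈ (ℤₚ.+-identityˡ a)) , (λ a → ≡⇒≈ (ℤₚ.+-identityʳ a)) }
            ; inverse = (λ a → ≡⇒≈ (ℤₚ.+-inverseˡ a)) , (λ a → ≡⇒≈ (ℤₚ.+-inverseʳ a))
            ; ⁻¹-cong = λ { {_} {b} (w by ≡.refl) → ℤ.- w by solve 3 (λ b p w → :- (b :+ p :* w) := :- b :+ p :* (:- w)) ≡.refl b p w } }
          ; comm = λ a b → ≡⇒≈ (ℤₚ.+-comm a b) }
        ; *-cong = λ { {_} {b} {_} {d} (w by ≡.refl) (v by ≡.refl) → (b ℤ.* v ℤ.+ w ℤ.* d ℤ.+ p ℤ.* w ℤ.* v) by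
            solve 5 (λ b d p w v → (b :+ p :* w) :* (d :+ p :* v) := (b :* d) :+ p :* (b :* v :+ w :* d :+ p :* w :* v)) ≡.refl b d p w v }
        ; *-assoc = λ a b c → ≡⇒≈ (ℤₚ.*-assoc a b c)
        ; *-identity = (λ a → ≡⇒≈ (ℤₚ.*-identityˡ a)) , (λ a → ≡⇒≈ (ℤₚ.*-identityʳ a))
        ; distrib = (λ a b c → ≡⇒≈ (ℤₚ.*-distribˡ-+ a b c)) , (λ a b c → ≡⇒≈ (ℤₚ.*-distribʳ-+ a b c)) }
      ; *-comm = λ a b → ≡⇒≈ (ℤₚ.*-comm a b) }
    }

module ModuloPrime (e : Exponent) where
  open Modulo (+ prime e) public renaming (ring to ℤ/p)
  open CommutativeRing ℤ/p using (sym; trans)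
  open Frobenius ℤ/p

  ℤ/p-char : HasCharacteristic e
  ℤ/p-char x = x by identity e x
    where
    open IntegerCoefficients ℤₚ.+-*-commutativeRing using (solve; _:=_; _:+_; _:*_; con)
    identity : ∀ e x → power ℤ._+_ e x ≡ + 0 ℤ.+ + prime e ℤ.* x
    identity two   = solve 1 (λ x → x :+ x := con (+ 0) :+ con (+ 2) :* x) ≡.refl
    identity three = solve 1 (λ x → x :+ (x :+ x) := con (+ 0) :+ con (+ 3) :* x) ≡.refl

  residue : ∀ a → ∃[ r ] a ≈ + toℕ {prime e} r
  residue a = let r , w , a≡ = go e in r , (w by a≡)
    where
    go : ∀ e → ∃[ r ] ∃[ w ] a ≡ + toℕ {prime e} r ℤ.+ + prime e ℤ.* w
    go two   = fromℕ< (n%ℕd<d a 2) , a /ℕ 2 , ≡.trans (a≡a%ℕn+[a/ℕn]*n a 2)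
      (≡.cong₂ ℤ._+_ (≡.cong +_ (≡.sym (Finₚ.toℕ-fromℕ< _))) (ℤₚ.*-comm (a /ℕ 2) (+ 2)))
    go three = fromℕ< (n%ℕd<d a 3) , a /ℕ 3 , ≡.trans (a≡a%ℕn+[a/ℕn]*n a 3)
      (≡.cong₂ ℤ._+_ (≡.cong +_ (≡.sym (Finₚ.toℕ-fromℕ< _))) (ℤₚ.*-comm (a /ℕ 3) (+ 3)))

  fermat : ∀ a → a ^ e ≈ a
  fermat a with residue a
  ... | r , a≈r = trans (^-cong e a≈r) (trans (let w , eq = go e r in w by eq) (sym a≈r))
    where
    go : ∀ e (r : Fin (prime e)) → ∃[ w ] power ℤ._*_ e (+ toℕ r) ≡ + toℕ r ℤ.+ + prime e ℤ.* w
    go two   zero             = + 0 , ≡.refl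
    go two   (suc zero)       = + 0 , ≡.refl
    go three zero             = + 0 , ≡.refl
    go three (suc zero)       = + 0 , ≡.refl
    go three (suc (suc zero)) = + 2 , ≡.refl

  unit⊎zero : ∀ a → (∃[ d ] a ℤ.* d ≈ + 1) ⊎ (a ≈ + 0)
  unit⊎zero a with residue a
  ... | r , a≈r = Sum.map (λ (d , w , rd≡1) → d , trans (CommutativeRing.*-congʳ ℤ/p a≈r) (w by rd≡1)) (λ r≡0 → trans a≈r (≡⇒≈ r≡0)) (go e r)
    where
    go : ∀ e (r : Fin (prime e)) → (∃[ d ] ∃[ w ] + toℕ r ℤ.* d ≡ + 1 ℤ.+ + prime e ℤ.* w) ⊎ (+ toℕ r ≡ + 0)
    go two   zero             = inj₂ ≡.refl
    go three zero             = inj₂ ≡.refl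
    go two   (suc zero)       = inj₁ (+ 1 , + 0 , ≡.refl)
    go three (suc zero)       = inj₁ (+ 1 , + 0 , ≡.refl)
    go three (suc (suc zero)) = inj₁ (+ 2 , + 1 , ≡.refl)

  pigeonhole : ∀ {m} (s : ℕ → Fin m → ℤ) → ∃[ a ] ∃[ d ] (∀ k → s a k ≈ s (suc d ℕ.+ a) k)
  pigeonhole {m} s with Finₚ.pigeonhole {prime e ℕ.^ m} ℕₚ.≤-refl (code ∘ s ∘ toℕ)
    where
    code : (Fin m → ℤ) → Fin (prime e ℕ.^ m)
    code x = funToFin (λ k → proj₁ (residue (x k)))
  ... | i , j , i<j , eq = toℕ i , d , λ k → trans (trans (proj₂ (residue _)) (≡⇒≈ (≡.cong (λ r → + toℕ r)
      (≡.trans (≡.sym (Finₚ.finToFun-funToFin _ k)) (≡.trans (≡.cong (λ c → finToFun c k) eq) (Finₚ.finToFun-funToFin _ k))))))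
      (trans (sym (proj₂ (residue _))) (≡⇒≈ (≡.cong (λ n → s n k) (≡.sym suc-d+i))))
    where
    d = toℕ j ℕ.∸ suc (toℕ i)
    suc-d+i : suc d ℕ.+ toℕ i ≡ toℕ j
    suc-d+i = ≡.trans (≡.sym (ℕₚ.+-suc d (toℕ i))) (ℕₚ.m∸n+n≡m i<j)

-- Sums of sixth powers of matrices

module SixthPowers {c ℓ} (R : CommutativeRing c ℓ) where
  open CommutativeRing R hiding (zero)
  open Sums R
  open Determinants R using (Rows; _≈ᵣ_)
  open Frobenius R
  open Matrices R
  open IntegerCoefficients R using (⟦_⟧ℕ; solve; _:=_; _:+_; _:*_; _:-_; :-_; con)
  module M {n} = Ring (matrixRing n)

  sixth : ∀ {n} → Rows n n → Rows n n
  sixth A = A ⊗ (A ⊗ (A ⊗ (A ⊗ (A ⊗ A))))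

  sixth≈square : ∀ {n} (A : Rows n n) → sixth A ≈ᵣ power _⊗_ two (power _⊗_ three A)
  sixth≈square A = M.sym (M.trans (⊗-assoc A (A ⊗ A) _) (M.*-congˡ {x = A} (⊗-assoc A A _)))

  sixth≈cube : ∀ {n} (A : Rows n n) → sixth A ≈ᵣ power _⊗_ three (power _⊗_ two A)
  sixth≈cube A = M.sym (M.trans (⊗-assoc A A _) (M.*-congˡ {x = A} (M.*-congˡ {x = A} (⊗-assoc A A _))))

  data IsSum {n} (M : Rows n n) : Set (c Level.⊔ ℓ) where
    single : ∀ A → M ≈ᵣ sixth A → IsSum M
    more   : ∀ A {N} → M ≈ᵣ sixth A ⊕ N → IsSum N → IsSum M

  IsSum-cong : ∀ {n} {M N : Rows n n} → M ≈ᵣ N → IsSum M → IsSum N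
  IsSum-cong M≈N (single A M≈)   = single A (M.trans (M.sym M≈N) M≈)
  IsSum-cong M≈N (more A M≈ sum) = more A (M.trans (M.sym M≈N) M≈) sum

  IsSum-⊕ : ∀ {n} {M N : Rows n n} → IsSum M → IsSum N → IsSum (M ⊕ N)
  IsSum-⊕ (single A M≈)         N-sum = more A (M.+-congʳ M≈) N-sum
  IsSum-⊕ {N = N} (more A {M′} M≈ M′-sum) N-sum =
    more A (M.trans (M.+-congʳ {x = N} M≈) (M.+-assoc (sixth A) M′ N)) (IsSum-⊕ M′-sum N-sum)

  idempotent-IsSum : ∀ {n} {E : Rows n n} → E ⊗ E ≈ᵣ E → IsSum E
  idempotent-IsSum {E = E} E²≈E = single E (M.sym (absorb (absorb (absorb (absorb E²≈E)))))
    where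
    absorb : ∀ {X} → X ≈ᵣ E → E ⊗ X ≈ᵣ E
    absorb X≈E = M.trans (M.*-congˡ {x = E} X≈E) E²≈E

  IsSum-sum : ∀ {n m} (f : Fin m → Rows n n) → (∀ i → IsSum (f i)) → IsSum (λ k l → sum (λ i → f i k l))
  -- A sum has at least one summand, so the empty case is represented by the sixth power of the zero
  -- matrix.
  IsSum-sum {m = zero}  f f-sum = IsSum-cong (λ k l → sym (sum-[] _)) (idempotent-IsSum (M.zeroˡ M.0#))
  IsSum-sum {m = suc m} f f-sum = IsSum-cong (λ k l → sym (sum-∷ _)) (IsSum-⊕ (f-sum zero) (IsSum-sum (f ∘ suc) (f-sum ∘ suc)))

  tr-sixth : ∀ e → HasCharacteristic e → ∀ {n} (A : Rows n n) → ∃[ y ] y ^ e ≈ tr (sixth A)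
  tr-sixth two   char A = tr (power _⊗_ three A) , trans (sym (tr-power two char (power _⊗_ three A))) (tr-cong (M.sym (sixth≈square A)))
  tr-sixth three char A = tr (power _⊗_ two A) , trans (sym (tr-power three char (power _⊗_ two A))) (tr-cong (M.sym (sixth≈cube A)))

  tr-IsSum : ∀ e → HasCharacteristic e → ∀ {n} {M : Rows n n} → IsSum M → ∃[ y ] y ^ e ≈ tr M
  tr-IsSum e char (single A M≈) with tr-sixth e char A
  ... | y , yᵉ≈ = y , trans yᵉ≈ (sym (tr-cong M≈))
  tr-IsSum e char (more A {N} M≈ N-sum) with tr-sixth e char A | tr-IsSum e char N-sum
  ... | y , yᵉ≈ | z , zᵉ≈ = y + z , trans (^-+ e char y z) (trans (+-cong yᵉ≈ zᵉ≈) (sym (trans (tr-cong M≈) (tr-⊕ (sixth A) N))))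

  root-of-IsSum : ∀ e → HasCharacteristic e → ∀ {n} → (∀ (M : Rows (suc n) (suc n)) → IsSum M) → ∀ x → ∃[ y ] y ^ e ≈ x
  -- The matrix with x in its first diagonal place and zeros elsewhere has trace x.
  root-of-IsSum e char all x with tr-IsSum e char (all (λ { zero zero → x ; zero (suc _) → 0# ; (suc _) _ → 0# }))
  ... | y , yᵉ≈ = y , trans yᵉ≈ (trans (sum-∷ _) (trans (+-congˡ (sum-zero (λ _ → refl))) (+-identityʳ x)))

  -- Two by two matrices

  mat : (a b c d : Carrier) → Rows 2 2
  mat a b c d zero       zero       = a
  mat a b c d zero       (suc zero) = b
  mat a b c d (suc zero) zero       = c
  mat a b c d (suc zero) (suc zero) = d

  mat-cong : ∀ {a b c d} {A : Rows 2 2} → A zero zero ≈ a → A zero (suc zero) ≈ b →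
             A (suc zero) zero ≈ c → A (suc zero) (suc zero) ≈ d → A ≈ᵣ mat a b c d
  mat-cong a b c d zero       zero       = a
  mat-cong a b c d zero       (suc zero) = b
  mat-cong a b c d (suc zero) zero       = c
  mat-cong a b c d (suc zero) (suc zero) = d

  sum-two : ∀ (f : Fin 2 → Carrier) → sum f ≈ f zero + f (suc zero)
  sum-two f = trans (sum-∷ f) (+-congˡ (trans (sum-∷ _) (trans (+-congˡ (sum-[] _)) (+-identityʳ _))))

  mat-⊗ : ∀ {a b c d a′ b′ c′ d′ p q r s} → a * a′ + b * c′ ≈ p → a * b′ + b * d′ ≈ q → c * a′ + d * c′ ≈ r → c * b′ + d * d′ ≈ s →
          mat a b c d ⊗ mat a′ b′ c′ d′ ≈ᵣ mat p q r s
  mat-⊗ p q r s = mat-cong (trans (sum-two _) p) (trans (sum-two _) q) (trans (sum-two _) r) (trans (sum-two _) s)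

  IsSum₂ : (a b c d : Carrier) → Set _
  IsSum₂ a b c d = IsSum (mat a b c d)

  _⟨+⟩_ : ∀ {a b c d a′ b′ c′ d′} → IsSum₂ a b c d → IsSum₂ a′ b′ c′ d′ → IsSum₂ (a + a′) (b + b′) (c + c′) (d + d′)
  A ⟨+⟩ B = IsSum-cong (mat-cong refl refl refl refl) (IsSum-⊕ A B)

  IsSum₂-cong : ∀ {a b c d a′ b′ c′ d′} → a ≈ a′ → b ≈ b′ → c ≈ c′ → d ≈ d′ → IsSum₂ a b c d → IsSum₂ a′ b′ c′ d′
  IsSum₂-cong a b c d = IsSum-cong (mat-cong a b c d)

  idempotent₂ : ∀ {a b c d} → a * a + b * c ≈ a → a * b + b * d ≈ b → c * a + d * c ≈ c → c * b + d * d ≈ d → IsSum₂ a b c d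
  idempotent₂ a b c d = idempotent-IsSum (mat-⊗ a b c d)

  upper-idempotent : ∀ a → IsSum₂ 1# a 0# 0#
  upper-idempotent a = idempotent₂
    (solve 1 (λ a → con (+ 1) :* con (+ 1) :+ a :* con (+ 0) := con (+ 1)) refl a)
    (solve 1 (λ a → con (+ 1) :* a :+ a :* con (+ 0) := a) refl a)
    (solve 0 (con (+ 0) :* con (+ 1) :+ con (+ 0) :* con (+ 0) := con (+ 0)) refl)
    (solve 1 (λ a → con (+ 0) :* a :+ con (+ 0) :* con (+ 0) := con (+ 0)) refl a)

  lower-idempotent : ∀ a → IsSum₂ 0# 0# a 1#
  lower-idempotent a = idempotent₂
    (solve 1 (λ a → con (+ 0) :* con (+ 0) :+ con (+ 0) :* a := con (+ 0)) refl a)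
    (solve 0 (con (+ 0) :* con (+ 0) :+ con (+ 0) :* con (+ 1) := con (+ 0)) refl)
    (solve 1 (λ a → a :* con (+ 0) :+ con (+ 1) :* a := a) refl a)
    (solve 1 (λ a → a :* con (+ 0) :+ con (+ 1) :* con (+ 1) := con (+ 1)) refl a)

  -- Its diagonal is (1 - a, a). Up to the constant 1 and to off-diagonal entries it moves a from
  -- one diagonal place to the other.
  row-idempotent : ∀ a → IsSum₂ (1# - a) a (1# - a) a
  row-idempotent a = idempotent₂
    (solve 1 (λ a → (con (+ 1) :- a) :* (con (+ 1) :- a) :+ a :* (con (+ 1) :- a) := con (+ 1) :- a) refl a)
    (solve 1 (λ a → (con (+ 1) :- a) :* a :+ a :* a := a) refl a)
    (solve 1 (λ a → (con (+ 1) :- a) :* (con (+ 1) :- a) :+ a :* (con (+ 1) :- a) := con (+ 1) :- a) refl a)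
    (solve 1 (λ a → (con (+ 1) :- a) :* a :+ a :* a := a) refl a)

  -- The square of [[0, e], [1, 0]] is the scalar e.
  scalar-cube : ∀ e → IsSum₂ (e * (e * e)) 0# 0# (e * (e * e))
  scalar-cube e = single (mat 0# e 1# 0#) (M.sym (M.trans (sixth≈cube _) (M.trans (cube-cong (mat-⊗ {p = e} {0#} {0#} {e}
    (solve 1 (λ e → con (+ 0) :* con (+ 0) :+ e :* con (+ 1) := e) refl e)
    (solve 1 (λ e → con (+ 0) :* e :+ e :* con (+ 0) := con (+ 0)) refl e)
    (solve 0 (con (+ 1) :* con (+ 0) :+ con (+ 0) :* con (+ 1) := con (+ 0)) refl)
    (solve 1 (λ e → con (+ 1) :* e :+ con (+ 0) :* con (+ 0) := e) refl e)))
    (M.trans (M.*-congˡ {x = mat e 0# 0# e} (scalar-⊗ e e)) (scalar-⊗ e (e * e))))))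
    where
    cube-cong : ∀ {X Y : Rows 2 2} → X ≈ᵣ Y → power _⊗_ three X ≈ᵣ power _⊗_ three Y
    cube-cong X≈Y = M.*-cong X≈Y (M.*-cong X≈Y X≈Y)
    scalar-⊗ : ∀ e f → mat e 0# 0# e ⊗ mat f 0# 0# f ≈ᵣ mat (e * f) 0# 0# (e * f)
    scalar-⊗ e f = mat-⊗
      (solve 2 (λ e f → e :* f :+ con (+ 0) :* con (+ 0) := e :* f) refl e f)
      (solve 2 (λ e f → e :* con (+ 0) :+ con (+ 0) :* f := con (+ 0)) refl e f)
      (solve 2 (λ e f → con (+ 0) :* f :+ e :* con (+ 0) := con (+ 0)) refl e f)
      (solve 2 (λ e f → con (+ 0) :* con (+ 0) :+ e :* f := e :* f) refl e f)

  neg-identity : IsSum₂ (- 1#) 0# 0# (- 1#)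
  neg-identity = IsSum₂-cong cube refl refl cube (scalar-cube (- 1#))
    where
    cube : - 1# * (- 1# * - 1#) ≈ - 1#
    cube = solve 0 ((:- con (+ 1)) :* ((:- con (+ 1)) :* (:- con (+ 1))) := :- con (+ 1)) refl

  -- The off-diagonal entries are left unspecified, as only the trace matters. The matrix has
  -- characteristic polynomial t² - t - e, and its sixth power is computed as the square of its
  -- cube.
  companion-sixth : ∀ e → ∃[ b ] ∃[ c ] IsSum₂
    ((1# + e + e) * (1# + e + e) + (e + e * e) * (1# + e)) b c ((1# + e) * (e + e * e) + e * e)
  companion-sixth e = _ , _ , single (mat 1# e 1# 0#) (M.sym (M.trans (sixth≈square _) (M.trans (M.*-cong cube cube) (mat-⊗ refl refl refl refl))))
    where
    cube : power _⊗_ three (mat 1# e 1# 0#) ≈ᵣ mat (1# + e + e) (e + e * e) (1# + e) e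
    cube = M.trans (M.*-congˡ {x = mat 1# e 1# 0#} (mat-⊗ {p = 1# + e} {e} {1#} {e}
        (solve 1 (λ e → con (+ 1) :* con (+ 1) :+ e :* con (+ 1) := con (+ 1) :+ e) refl e)
        (solve 1 (λ e → con (+ 1) :* e :+ e :* con (+ 0) := e) refl e)
        (solve 0 (con (+ 1) :* con (+ 1) :+ con (+ 0) :* con (+ 1) := con (+ 1)) refl)
        (solve 1 (λ e → con (+ 1) :* e :+ con (+ 0) :* con (+ 0) := e) refl e)))
      (mat-⊗
        (solve 1 (λ e → con (+ 1) :* (con (+ 1) :+ e) :+ e :* con (+ 1) := con (+ 1) :+ e :+ e) refl e)
        (solve 1 (λ e → con (+ 1) :* e :+ e :* e := e :+ e :* e) refl e)
        (solve 1 (λ e → con (+ 1) :* (con (+ 1) :+ e) :+ con (+ 0) :* con (+ 1) := con (+ 1) :+ e) refl e)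
        (solve 1 (λ e → con (+ 1) :* e :+ con (+ 0) :* e := e) refl e))

  -- The idempotents [[1, a], [0, 0]] and [[0, 0], [0, 1]] add up to the identity plus the wanted
  -- entry, and -I removes the identity.
  upper : ∀ a → IsSum₂ 0# a 0# 0#
  upper a = IsSum₂-cong
    (solve 0 (:- con (+ 1) :+ (con (+ 1) :+ con (+ 0)) := con (+ 0)) refl)
    (solve 1 (λ a → con (+ 0) :+ (a :+ con (+ 0)) := a) refl a)
    (solve 0 (con (+ 0) :+ (con (+ 0) :+ con (+ 0)) := con (+ 0)) refl)
    (solve 0 (:- con (+ 1) :+ (con (+ 0) :+ con (+ 1)) := con (+ 0)) refl)
    (neg-identity ⟨+⟩ (upper-idempotent a ⟨+⟩ lower-idempotent 0#))

  lower : ∀ a → IsSum₂ 0# 0# a 0#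
  lower a = IsSum₂-cong
    (solve 0 (:- con (+ 1) :+ (con (+ 1) :+ con (+ 0)) := con (+ 0)) refl)
    (solve 0 (con (+ 0) :+ (con (+ 0) :+ con (+ 0)) := con (+ 0)) refl)
    (solve 1 (λ a → con (+ 0) :+ (con (+ 0) :+ a) := a) refl a)
    (solve 0 (:- con (+ 1) :+ (con (+ 0) :+ con (+ 1)) := con (+ 0)) refl)
    (neg-identity ⟨+⟩ (upper-idempotent 0# ⟨+⟩ lower-idempotent a))

  -- By `corner-trace` these are exactly the traces of 2 × 2 sums of sixth powers, so the problem
  -- becomes one about an additively closed set of scalars.
  Corner : Carrier → Set _
  Corner a = IsSum₂ a 0# 0# 0#

  corner-minus-one : Corner (- 1#)
  corner-minus-one = IsSum₂-cong
    (solve 0 (:- con (+ 1) :+ con (+ 0) := :- con (+ 1)) refl)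
    (solve 0 (con (+ 0) :+ con (+ 0) := con (+ 0)) refl)
    (solve 0 (con (+ 0) :+ con (+ 0) := con (+ 0)) refl)
    (solve 0 (:- con (+ 1) :+ con (+ 1) := con (+ 0)) refl)
    (neg-identity ⟨+⟩ lower-idempotent 0#)

  -- The matrix diag(d, -d) is added: `row-idempotent (- d)` has diagonal (1 + d, -d), the corner -1
  -- corrects the first entry, and `upper` and `lower` clear the rest.
  diagonal : ∀ a d → IsSum₂ a 0# 0# d → Corner (a + d)
  diagonal a d A = IsSum₂-cong
    (solve 2 (λ a d → (a :+ ((con (+ 1) :- (:- d)) :+ :- con (+ 1))) :+ (con (+ 0) :+ con (+ 0)) := a :+ d) refl a d)
    (solve 1 (λ d → (con (+ 0) :+ (:- d :+ con (+ 0))) :+ (d :+ con (+ 0)) := con (+ 0)) refl d)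
    (solve 1 (λ d → (con (+ 0) :+ ((con (+ 1) :- (:- d)) :+ con (+ 0))) :+ (con (+ 0) :+ (:- (con (+ 1) :- (:- d)))) := con (+ 0)) refl d)
    (solve 1 (λ d → (d :+ (:- d :+ con (+ 0))) :+ (con (+ 0) :+ con (+ 0)) := con (+ 0)) refl d)
    ((A ⟨+⟩ (row-idempotent (- d) ⟨+⟩ corner-minus-one)) ⟨+⟩ (upper d ⟨+⟩ lower (- (1# - (- d)))))

  corner-trace : ∀ {a b c d} → IsSum₂ a b c d → Corner (a + d)
  corner-trace {a} {b} {c} {d} A = diagonal a d (IsSum₂-cong
    (solve 1 (λ a → a :+ (con (+ 0) :+ con (+ 0)) := a) refl a)
    (solve 1 (λ b → b :+ (:- b :+ con (+ 0)) := con (+ 0)) refl b)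
    (solve 1 (λ c → c :+ (con (+ 0) :+ :- c) := con (+ 0)) refl c)
    (solve 1 (λ d → d :+ (con (+ 0) :+ con (+ 0)) := d) refl d)
    (A ⟨+⟩ (upper (- b) ⟨+⟩ lower (- c))))

  corner-cong : ∀ {a b} → a ≈ b → Corner a → Corner b
  corner-cong a≈b = IsSum₂-cong a≈b refl refl refl

  corner-+ : ∀ {a b} → Corner a → Corner b → Corner (a + b)
  corner-+ A B = IsSum₂-cong refl (+-identityʳ 0#) (+-identityʳ 0#) (+-identityʳ 0#) (A ⟨+⟩ B)

  corner-2x³ : ∀ x → Corner (x * (x * x) + x * (x * x))
  corner-2x³ x = corner-trace (scalar-cube x)

  -- From the trace 1 + 6x + 9x² + 2x³ the terms 1 and 2x³ can be removed although negation is not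
  -- yet available: -1 is a corner, and -2x³ is 2(-x)³.
  corner-9x²+6x : ∀ x → Corner (⟦ 9 ⟧ℕ * (x * x) + ⟦ 6 ⟧ℕ * x)
  corner-9x²+6x x with companion-sixth x
  ... | _ , _ , A = corner-cong
    (solve 1 (λ e → let o = con (+ 1) in
         (((o :+ e :+ e) :* (o :+ e :+ e) :+ (e :+ e :* e) :* (o :+ e)) :+ ((o :+ e) :* (e :+ e :* e) :+ e :* e))
         :+ (:- o :+ ((:- e) :* ((:- e) :* (:- e)) :+ (:- e) :* ((:- e) :* (:- e)))) := con (+ 9) :* (e :* e) :+ con (+ 6) :* e) refl x)
    (corner-+ (corner-trace A) (corner-+ corner-minus-one (corner-2x³ (- x))))

  corner-× : ∀ n {x} → Corner x → Corner (⟦ n ⟧ℕ * x)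
  corner-× zero          X = corner-cong (sym (zeroˡ _)) (idempotent-IsSum (mat-⊗ z z z z))
    where
    z : 0# * 0# + 0# * 0# ≈ 0#
    z = trans (+-cong (zeroˡ 0#) (zeroˡ 0#)) (+-identityʳ 0#)
  corner-× (suc zero)    X = corner-cong (sym (*-identityˡ _)) X
  corner-× (suc (suc n)) X = corner-cong (sym (trans (distribʳ _ _ _) (+-congʳ (*-identityˡ _)))) (corner-+ X (corner-× (suc n) X))

  -- 2(x + 1)³ + 2(x - 1)³ + 4(- x)³ = 12x.
  corner-12x : ∀ x → Corner (⟦ 12 ⟧ℕ * x)
  corner-12x x = corner-cong
    (solve 1 (λ x → let cube = λ y → y :* (y :* y) :+ y :* (y :* y) in
       (cube (x :+ con (+ 1)) :+ cube (x :- con (+ 1))) :+ (cube (:- x) :+ cube (:- x)) := con (+ 12) :* x) refl x)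
    (corner-+ (corner-+ (corner-2x³ (x + 1#)) (corner-2x³ (x - 1#))) (corner-+ (corner-2x³ (- x)) (corner-2x³ (- x))))

  -- Adding x eleven times and then 12(-x), a corner for every x, gives -x.
  corner-neg : ∀ {x} → Corner x → Corner (- x)
  corner-neg {x} X = corner-cong (solve 1 (λ x → con (+ 11) :* x :+ con (+ 12) :* (:- x) := :- x) refl x)
    (corner-+ (corner-× 11 X) (corner-12x (- x)))

  -- Polarisation of q(y) = 9y² + 6y: the difference q(x + 1) - q(x) - q(1) is 18x, from which 12x
  -- is subtracted.
  corner-6x : ∀ x → Corner (⟦ 6 ⟧ℕ * x)
  corner-6x x = corner-cong
    (solve 1 (λ x → let q = λ y → con (+ 9) :* (y :* y) :+ con (+ 6) :* y in
       (q (x :+ con (+ 1)) :+ (:- (q x) :+ :- (q (con (+ 1))))) :+ con (+ 12) :* (:- x) := con (+ 6) :* x) refl x)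
    (corner-+ (corner-+ (corner-9x²+6x (x + 1#)) (corner-+ (corner-neg (corner-9x²+6x x)) (corner-neg (corner-9x²+6x 1#)))) (corner-12x (- x)))

  -- Modulo 6 every 3x is 9y² and every 2x is 2y³, whence x = 3x - 2x.
  corner : (∀ x → ∃[ y ] ∃[ w ] x ≈ y ^ two + power _+_ two w) →
           (∀ x → ∃[ y ] ∃[ w ] x ≈ y ^ three + power _+_ three w) → ∀ x → Corner x
  corner squares cubes x with squares x | cubes x
  ... | y , w , x≈y²+2w | z , v , x≈z³+3v = corner-cong (trans
      (+-cong (solve 2 (λ y w → (con (+ 9) :* (y :* y) :+ con (+ 6) :* y) :+ con (+ 6) :* (w :- (y :+ y :* y)) := con (+ 3) :* (y :* y :+ (w :+ w))) refl y w)
              (-‿cong (solve 2 (λ z v → (z :* (z :* z) :+ z :* (z :* z)) :+ con (+ 6) :* v := con (+ 2) :* (z :* (z :* z) :+ (v :+ (v :+ v)))) refl z v)))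
      (trans (sym (+-cong (*-congˡ x≈y²+2w) (-‿cong (*-congˡ x≈z³+3v))))
             (solve 1 (λ x → con (+ 3) :* x :+ :- (con (+ 2) :* x) := x) refl x)))
    (corner-+ (corner-+ (corner-9x²+6x y) (corner-6x (w - (y + y * y)))) (corner-neg (corner-+ (corner-2x³ z) (corner-6x v))))

  -- From two coordinates to all matrices

  module _ {n} {i j : Fin n} (i≢j : i ≢ j) where
    private
      rows : Rows 2 n
      rows zero       l = δ i l
      rows (suc zero) l = δ j l

      columns : Rows n 2
      columns k a = rows a k

      rows⊗columns : rows ⊗ columns ≈ᵣ δ
      rows⊗columns zero       zero       = trans (sum-δˡ i _) (δ-refl i)
      rows⊗columns zero       (suc zero) = trans (sum-δˡ i _) (δ-≢ (i≢j ∘ ≡.sym))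
      rows⊗columns (suc zero) zero       = trans (sum-δˡ j _) (δ-≢ i≢j)
      rows⊗columns (suc zero) (suc zero) = trans (sum-δˡ j _) (δ-refl j)

    -- `rows` selects coordinates i and j, and `rows ⊗ columns` is the 2 × 2 identity. The map is
    -- therefore additive and multiplicative, and although it does not preserve 1 it carries sixth
    -- powers to sixth powers.
    embed : Rows 2 2 → Rows n n
    embed A = columns ⊗ (A ⊗ rows)

    embed-cong : ∀ {A B} → A ≈ᵣ B → embed A ≈ᵣ embed B
    embed-cong {A} {B} A≈B = ⊗-cong {A = columns} {B = A ⊗ rows} (λ _ _ → refl) (⊗-cong {B = rows} A≈B (λ _ _ → refl))

    embed-⊗ : ∀ A B → embed A ⊗ embed B ≈ᵣ embed (A ⊗ B)
    embed-⊗ A B k l = begin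
      (columns ⊗ (A ⊗ rows) ⊗ (columns ⊗ (B ⊗ rows))) k l
        ≈⟨ ⊗-assoc columns (A ⊗ rows) (columns ⊗ (B ⊗ rows)) k l ⟩
      (columns ⊗ (A ⊗ rows ⊗ (columns ⊗ (B ⊗ rows)))) k l
        ≈⟨ ⊗-cong {A = columns} (λ _ _ → refl) middle k l ⟩
      (columns ⊗ (A ⊗ B ⊗ rows)) k l ∎
      where
      open Relation.Binary.Reasoning.Setoid setoid
      middle : A ⊗ rows ⊗ (columns ⊗ (B ⊗ rows)) ≈ᵣ A ⊗ B ⊗ rows
      middle a l = begin
        (A ⊗ rows ⊗ (columns ⊗ (B ⊗ rows))) a l    ≈⟨ ⊗-assoc A rows (columns ⊗ (B ⊗ rows)) a l ⟩
        (A ⊗ (rows ⊗ (columns ⊗ (B ⊗ rows)))) a l  ≈⟨ ⊗-cong {A = A} (λ _ _ → refl) (λ b l → trans (sym (⊗-assoc rows columns (B ⊗ rows) b l))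
                                                        (trans (⊗-cong {B = B ⊗ rows} rows⊗columns (λ _ _ → refl) b l) (⊗-identityˡ (B ⊗ rows) b l))) a l ⟩
        (A ⊗ (B ⊗ rows)) a l                       ≈⟨ ⊗-assoc A B rows a l ⟨
        (A ⊗ B ⊗ rows) a l                         ∎

    embed-⊕ : ∀ A B → embed (A ⊕ B) ≈ᵣ embed A ⊕ embed B
    embed-⊕ A B k l = trans (sum-cong (λ a → trans (*-congˡ (trans (sum-cong (λ b → distribʳ _ _ _)) (sum-+ _ _))) (distribˡ _ _ _))) (sum-+ _ _)

    embed-sixth : ∀ A → embed (sixth A) ≈ᵣ sixth (embed A)
    embed-sixth A = grow (grow (grow (grow (grow {X = A} (λ _ _ → refl)))))
      where
      grow : ∀ {X Y} → embed X ≈ᵣ Y → embed (A ⊗ X) ≈ᵣ embed A ⊗ Y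
      grow {X} X≈Y = M.trans (M.sym (embed-⊗ A X)) (M.*-congˡ {x = embed A} X≈Y)

    embed-IsSum : ∀ {A} → IsSum A → IsSum (embed A)
    embed-IsSum (single B A≈)      = single (embed B) (M.trans (embed-cong A≈) (embed-sixth B))
    embed-IsSum (more B {N} A≈ N-sum) = more (embed B)
      (M.trans (embed-cong A≈) (M.trans (embed-⊕ (sixth B) N) (M.+-congʳ {x = embed N} (embed-sixth B)))) (embed-IsSum N-sum)

    embed-mat : ∀ a b k l → embed (mat a b 0# 0#) k l ≈ δ i k * (a * δ i l + b * δ j l)
    embed-mat a b k l = trans (sum-two _) (trans (+-cong (*-congˡ (sum-two _)) (trans (*-congˡ (trans (sum-two _)
      (trans (+-cong (zeroˡ _) (zeroˡ _)) (+-identityʳ 0#)))) (zeroʳ _))) (+-identityʳ _))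

  module _ (corners : ∀ x → Corner x) {n : ℕ} where
    unit-IsSum : ∀ (i j : Fin (suc (suc n))) a → IsSum (λ k l → δ i k * (a * δ j l))
    unit-IsSum i j a with i Finₚ.≟ j
    ... | no i≢j = IsSum-cong (λ k l → trans (embed-mat i≢j 0# a k l) (*-congˡ (trans (+-congʳ (zeroˡ _)) (+-identityˡ _)))) (embed-IsSum i≢j (upper a))
    ... | yes ≡.refl = IsSum-cong (λ k l → trans (embed-mat i≢i′ a 0# k l) (*-congˡ (trans (+-congˡ (zeroˡ _)) (+-identityʳ _)))) (embed-IsSum i≢i′ (corners a))
      where
      -- A diagonal entry needs a second coordinate to share a 2 × 2 block with; `punchIn i zero` is
      -- one, available because the size is at least 2.
      i≢i′ : i ≢ punchIn i zero
      i≢i′ = punchInᵢ≢i i zero ∘ ≡.sym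

    all-IsSum : ∀ (M : Rows (suc (suc n)) (suc (suc n))) → IsSum M
    all-IsSum M = IsSum-cong
      (λ k l → trans (sum-cong (λ i → trans (sym (sum-*ˡ _ _)) (*-cong (δ-comm i k) (sum-δʳ l (M i))))) (sum-δˡ k (λ i → M i l)))
      (IsSum-sum (λ i k l → sum (λ j → δ i k * (M i j * δ j l)))
        (λ i → IsSum-sum (λ j k l → δ i k * (M i j * δ j l)) (λ j → unit-IsSum i j (M i j))))

-- Orders

module DefsModulo (e : Exponent) where
  open ModuloPrime e using (ℤ/p)
  open Sums ℤ/p using (δ)
  open Determinants ℤ/p using (det; sign)

  -- The operations of `ℤ/p` are those of ℤ, only its equality differs, so the two determinants are
  -- equal integers and not merely congruent ones.
  det≡ : ∀ {k} (A : Fin k → Fin k → ℤ) → Defs.det A ≡ det A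
  det≡ {zero}  A = ≡.refl
  det≡ {suc k} A = ≡.trans (det-expand A) (≡.trans
    (Σℤ-cong {f = λ j → signℤ j ℤ.* cofactor A j} (λ j → ≡.cong₂ (λ s d → s ℤ.* (A zero j ℤ.* d)) (sign≡ j) (det≡ (λ r c → A (suc r) (punchIn j c)))))
    (Σℤ≡fold (λ j → sign j ℤ.* (A zero j ℤ.* det (λ r c → A (suc r) (punchIn j c))))))
    where
    sign≡ : ∀ {l} (j : Fin l) → signℤ j ≡ sign j
    sign≡ zero    = ≡.refl
    sign≡ (suc j) = ≡.cong ℤ.-_ (sign≡ j)

  δ-diagonal : ∀ {n} (i : Fin n) → δ i i ≡ + 1
  δ-diagonal zero    = ≡.refl
  δ-diagonal (suc i) = δ-diagonal i

  δ-off-diagonal : ∀ {n} {i j : Fin n} → i ≢ j → δ i j ≡ + 0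
  δ-off-diagonal {i = zero}  {zero}  i≢j = ⊥-elim (i≢j ≡.refl)
  δ-off-diagonal {i = zero}  {suc j} i≢j = ≡.refl
  δ-off-diagonal {i = suc i} {zero}  i≢j = ≡.refl
  δ-off-diagonal {i = suc i} {suc j} i≢j = δ-off-diagonal (i≢j ∘ ≡.cong suc)

  basis≡δ : ∀ {n} (i j : Fin n) → basis i j ≡ δ i j
  basis≡δ i j with i Finₚ.≟ j
  ... | yes ≡.refl = ≡.sym (δ-diagonal i)
  ... | no  i≢j    = ≡.sym (δ-off-diagonal i≢j)

module OverOrder (O : Order) where
  open Order O

  module ℤAlg = StructureConstants ℤₚ.+-*-commutativeRing sc

  mulSC≡⋆ : ∀ x y k → mulSC sc x y k ≡ (x ℤAlg.⋆ y) k
  mulSC≡⋆ x y k = ≡.trans (Σℤ-cong {f = λ i → Σℤ (λ j → term i j)} (λ i → Σℤ≡fold (term i))) (Σℤ≡fold (λ i → fold ℤ._+_ (+ 0) (term i)))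
    where
    term : Fin deg → Fin deg → ℤ
    term i j = x i ℤ.* (y j ℤ.* sc i j k)

  isAlgebra : ℤAlg.IsCommutativeAlgebra one
  isAlgebra = record
    { ⋆-comm      = λ x y k → ≡.trans (≡.sym (mulSC≡⋆ x y k)) (≡.trans (·-comm x y k) (mulSC≡⋆ y x k))
    ; ⋆-assoc     = λ x y z k → ≡.trans (≡.sym (triple (x ℤAlg.⋆ y) (x · y) z z (≡.sym ∘ mulSC≡⋆ x y) (λ _ → ≡.refl) k))
        (≡.trans (·-assoc x y z k) (triple x x (y ℤAlg.⋆ z) (y · z) (λ _ → ≡.refl) (≡.sym ∘ mulSC≡⋆ y z) k))
    ; ⋆-identityˡ = λ x k → ≡.trans (≡.sym (mulSC≡⋆ one x k)) (·-identityˡ x k)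
    }
    where
    triple : ∀ u u′ v v′ → (∀ k → u k ≡ u′ k) → (∀ k → v k ≡ v′ k) → ∀ k → (u′ · v′) k ≡ (u ℤAlg.⋆ v) k
    triple u u′ v v′ u≡ v≡ k = ≡.trans (mulSC≡⋆ u′ v′ k) (≡.sym (ℤAlg.⋆-cong u≡ v≡ k))

  𝒪 : CommutativeRing _ _
  𝒪 = ℤAlg.IsCommutativeAlgebra.algebra isAlgebra

  module 𝒪 = CommutativeRing 𝒪
  module S = SixthPowers 𝒪
  open Matrices 𝒪 using (_⊗_)

  ΣE≡fold : ∀ {n} (f : Fin n → Elt deg) k → ΣE O f k ≡ fold 𝒪._+_ 𝒪.0# f k
  ΣE≡fold {zero}  f k = ≡.sym (≡.cong (_$ k) (fold-[] 𝒪._+_ 𝒪.0# f))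
  ΣE≡fold {suc n} f k = ≡.trans (≡.cong (λ s → f zero k ℤ.+ s) (ΣE≡fold (f ∘ suc) k)) (≡.sym (≡.cong (_$ k) (fold-∷ 𝒪._+_ 𝒪.0# f)))

  *M≈⊗ : ∀ {n} {A A′ B B′ : Mat O n} → A S.M.≈ A′ → B S.M.≈ B′ → _*M_ O A B S.M.≈ (A′ ⊗ B′)
  *M≈⊗ {A = A} {A′} {B} {B′} A≈ B≈ i j k = ≡.trans (ΣE≡fold (λ l → A i l · B l j) k)
    (Sums.sum-cong 𝒪 {f = λ l → A i l · B l j} {λ l → A′ i l 𝒪.* B′ l j} (λ l k → ≡.trans (mulSC≡⋆ (A i l) (B l j) k) (𝒪.*-cong (A≈ i l) (B≈ l j) k)) k)

  sixth≈ : ∀ {n} (A : Mat O n) → Defs.sixth O A S.M.≈ S.sixth A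
  sixth≈ A = grow (grow (grow (grow (grow A≈A))))
    where
    A≈A : A S.M.≈ A
    A≈A _ _ _ = ≡.refl
    grow : ∀ {X Y} → X S.M.≈ Y → _*M_ O A X S.M.≈ (A ⊗ Y)
    grow = *M≈⊗ A≈A

  to : ∀ {n} {M : Mat O n} → IsSumOfSixthPowers O M → S.IsSum M
  to {n} {M} (r , Ms , M≈) = go r Ms M≈
    where
    go : ∀ r (Ms : Fin (suc r) → Mat O n) {M} → M S.M.≈ sumSixth O Ms → S.IsSum M
    go zero    Ms M≈ = S.single (Ms zero) (S.M.trans M≈ (sixth≈ (Ms zero)))
    go (suc r) Ms M≈ = S.more (Ms zero) (S.M.trans M≈ (S.M.+-congʳ {x = sumSixth O (Ms ∘ suc)} (sixth≈ (Ms zero)))) (go r (Ms ∘ suc) S.M.refl)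

  from : ∀ {n} {M : Mat O n} → S.IsSum M → IsSumOfSixthPowers O M
  from (S.single A M≈) = 0 , (λ _ → A) , S.M.trans M≈ (S.M.sym (sixth≈ A))
  from (S.more A {N} M≈ N-sum) with from N-sum
  ... | r , Ms , N≈ = suc r , (λ { zero → A ; (suc i) → Ms i }) , S.M.trans M≈ (S.M.+-cong (S.M.sym (sixth≈ A)) N≈)

  module Reduction (e : Exponent) where
    open ModuloPrime e
    module F = CommutativeRing ℤ/p
    module Alg = StructureConstants ℤ/p sc
    open Sums ℤ/p using (δ; sum-cong)
    open Determinants ℤ/p using (det; det-cong)
    open DefsModulo e

    -- The products over ℤ and over ℤ/p are the same function on integer vectors, so each law is an
    -- integer equality weakened to a congruence.
    isAlgebra/p : Alg.IsCommutativeAlgebra one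
    isAlgebra/p = record
      { ⋆-comm      = λ x y k → ≡⇒≈ (𝒪.*-comm x y k)
      ; ⋆-assoc     = λ x y z k → ≡⇒≈ (𝒪.*-assoc x y z k)
      ; ⋆-identityˡ = λ x k → ≡⇒≈ (𝒪.*-identityˡ x k)
      }

    open Alg.IsCommutativeAlgebra isAlgebra/p using (det-traceForm-unit; ^-injective₀) renaming (algebra to 𝒪/p)
    module 𝒪/p = CommutativeRing 𝒪/p

    𝒪/p-char : Frobenius.HasCharacteristic 𝒪/p e
    𝒪/p-char x k = pointwise e (ℤ/p-char (x k))
      where
      -- `power` computes only at a known exponent. The case split is on a separate e′, because the
      -- congruence itself depends on e.
      pointwise : ∀ e′ → power ℤ._+_ e′ (x k) ≈ + 0 → power 𝒪._+_ e′ x k ≈ + 0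
      pointwise two   eq = eq
      pointwise three eq = eq

    open IterateFrobenius 𝒪/p e

    ·≈⋆ : ∀ {x x′ y y′} → (∀ k → x k ≈ x′ k) → (∀ k → y k ≈ y′ k) → ∀ k → (x · y) k ≈ (x′ Alg.⋆ y′) k
    ·≈⋆ {x} {y = y} x≈ y≈ k = F.trans (≡⇒≈ (mulSC≡⋆ x y k)) (Alg.⋆-cong x≈ y≈ k)

    basis≈δ : ∀ i k → basis {deg} i k ≈ δ i k
    basis≈δ i k = ≡⇒≈ (basis≡δ i k)

    disc≈ : disc O ≈ det Alg.traceForm
    disc≈ = F.trans (≡⇒≈ (det≡ (λ i j → Defs.trace O (basis i · basis j)))) (det-cong (λ i j →
      F.trans (≡⇒≈ (Σℤ≡fold (λ k → ((basis i · basis j) · basis k) k)))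
      (sum-cong {f = λ k → ((basis i · basis j) · basis k) k} {λ k → ((δ i Alg.⋆ δ j) Alg.⋆ δ k) k} (λ k →
        ·≈⋆ {basis i · basis j} {δ i Alg.⋆ δ j} {basis k} {δ k} (·≈⋆ {basis i} {δ i} {basis j} {δ j} (basis≈δ i) (basis≈δ j)) (basis≈δ k) k))))

    reduce : ∀ {n} {M : Mat O n} → S.IsSum M → SixthPowers.IsSum 𝒪/p M
    reduce (S.single A M≈)     = SixthPowers.single A (λ i j k → ≡⇒≈ (M≈ i j k))
    reduce (S.more A M≈ N-sum) = SixthPowers.more A (λ i j k → ≡⇒≈ (M≈ i j k)) (reduce N-sum)

    finite : Finite
    finite s = pigeonhole s

    sums⇒roots : ∀ {n} → (∀ (M : Mat O (suc n)) → S.IsSum M) → ∀ x → ∃[ y ] (Frobenius._^_ 𝒪/p y e) 𝒪/p.≈ x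
    sums⇒roots all = SixthPowers.root-of-IsSum 𝒪/p e 𝒪/p-char (λ M → reduce {M = M} (all M))

    sums⇒periodic : ∀ {n} → (∀ (M : Mat O (suc n)) → S.IsSum M) → ∀ x → ∃[ d ] φ (suc d) x 𝒪/p.≈ x
    sums⇒periodic all = surjective⇒periodic finite (sums⇒roots all)

    sums⇒unit : ∀ {n} → (∀ (M : Mat O (suc n)) → S.IsSum M) → ∃[ d ] disc O ℤ.* d ≈ + 1
    sums⇒unit all = let d , unit = det-traceForm-unit e ℤ/p-char (λ i → sums⇒periodic all (δ i)) in
      d , F.trans (F.*-congʳ {d} disc≈) (F.trans (F.*-comm (det Alg.traceForm) d) unit)

    ^-kernel : ∀ d → disc O ℤ.* d ≈ + 1 → ∀ x → (Frobenius._^_ 𝒪/p x e) 𝒪/p.≈ 𝒪/p.0# → x 𝒪/p.≈ 𝒪/p.0#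
    ^-kernel d unit = ^-injective₀ e ℤ/p-char (λ a aᵉ≈0 → F.trans (F.sym (fermat a)) aᵉ≈0) d
      (F.trans (F.*-congʳ {d} (F.sym disc≈)) unit)

    unit⇒roots/p : ∀ d → disc O ℤ.* d ≈ + 1 → ∀ x → ∃[ y ] (Frobenius._^_ 𝒪/p y e) 𝒪/p.≈ x
    unit⇒roots/p d unit = injective⇒surjective finite (kernel-trivial⇒injective 𝒪/p-char (^-kernel d unit))

    -- The quotients stored in the coordinatewise congruences are the coordinates of w.
    lift-≈ : ∀ x y → x 𝒪/p.≈ y → ∃[ w ] x 𝒪.≈ (y 𝒪.+ power 𝒪._+_ e w)
    lift-≈ x y x≈y = w , λ k → ≡.trans (_≈_.equation (x≈y k)) (≡.cong (λ s → y k ℤ.+ s) (multiple e k))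
      where
      w : Elt deg
      w k = _≈_.quotient (x≈y k)
      open IntegerCoefficients ℤₚ.+-*-commutativeRing using (solve; _:=_; _:+_; _:*_; con)
      multiple : ∀ e k → + prime e ℤ.* w k ≡ power 𝒪._+_ e w k
      multiple two   k = solve 1 (λ w → con (+ 2) :* w := w :+ w) ≡.refl (w k)
      multiple three k = solve 1 (λ w → con (+ 3) :* w := w :+ (w :+ w)) ≡.refl (w k)

    unit⇒roots : ∀ d → disc O ℤ.* d ≈ + 1 → ∀ x → ∃[ y ] ∃[ w ] x 𝒪.≈ (Frobenius._^_ 𝒪 y e 𝒪.+ power 𝒪._+_ e w)
    unit⇒roots d unit x = let y , yᵉ≈x = unit⇒roots/p d unit x in
      y , lift-≈ x (Frobenius._^_ 𝒪 y e) (λ k → F.sym (yᵉ≈x k))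

-- Coprimality to 6 as invertibility modulo 2 and modulo 3

InvertibleModulo : Exponent → ℤ → Set
InvertibleModulo e a = ∃[ d ] a ℤ.* d ≈ + 1
  where open ModuloPrime e

prime∤1 : ∀ e → ¬ (prime e ℕ.∣ 1)
prime∤1 two   = from-no (2 ℕ.∣? 1)
prime∤1 three = from-no (3 ℕ.∣? 1)

prime∣6 : ∀ e → prime e ℕ.∣ 6
prime∣6 two   = from-yes (2 ℕ.∣? 6)
prime∣6 three = from-yes (3 ℕ.∣? 6)

≈0⇒∣ : ∀ e a → Modulo._≈_ (+ prime e) a (+ 0) → prime e ℕ.∣ ℤ.∣ a ∣
≈0⇒∣ e a (w Modulo.by a≡) = Signed.∣⇒∣ᵤ (Signed.divides w (≡.trans a≡ (≡.trans (ℤₚ.+-identityˡ _) (ℤₚ.*-comm (+ prime e) w))))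

invertible⇒∤ : ∀ e a → InvertibleModulo e a → ¬ (prime e ℕ.∣ ℤ.∣ a ∣)
invertible⇒∤ e a (d , ad≈1) p∣a with Signed.∣ᵤ⇒∣ {+ prime e} {a} p∣a
... | Signed.divides q a≡ = prime∤1 e (≈0⇒∣ e (+ 1) (F.trans (F.sym ad≈1) (F.trans (F.*-congʳ {d} {a} {+ 0} a≈0) (F.zeroˡ d))))
  where
  module F = CommutativeRing (ModuloPrime.ℤ/p e)
  a≈0 : Modulo._≈_ (+ prime e) a (+ 0)
  a≈0 = q Modulo.by ≡.trans a≡ (≡.trans (ℤₚ.*-comm q (+ prime e)) (≡.sym (ℤₚ.+-identityˡ _)))

∣6 : ∀ g → g ℕ.∣ 6 → g ≡ 1 ⊎ ∃[ e ] prime e ℕ.∣ g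
∣6 0 g∣6 = ⊥-elim (from-no (0 ℕ.∣? 6) g∣6)
∣6 1 g∣6 = inj₁ ≡.refl
∣6 2 g∣6 = inj₂ (two , from-yes (2 ℕ.∣? 2))
∣6 3 g∣6 = inj₂ (three , from-yes (3 ℕ.∣? 3))
∣6 4 g∣6 = inj₂ (two , from-yes (2 ℕ.∣? 4))
∣6 5 g∣6 = ⊥-elim (from-no (5 ℕ.∣? 6) g∣6)
∣6 6 g∣6 = inj₂ (two , from-yes (2 ℕ.∣? 6))
∣6 (suc (suc (suc (suc (suc (suc (suc g))))))) g∣6 = ⊥-elim (ℕₚ.<⇒≱ (s≤s (s≤s (s≤s (s≤s (s≤s (s≤s (s≤s z≤n))))))) (ℕ.∣⇒≤ g∣6))

gcd≡1 : ∀ a → (∀ e → InvertibleModulo e a) → gcd (+ 6) a ≡ + 1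
gcd≡1 a invertible with ∣6 (ℕ.gcd 6 ℤ.∣ a ∣) (ℕ.gcd[m,n]∣m 6 ℤ.∣ a ∣)
... | inj₁ g≡1       = ≡.cong +_ g≡1
... | inj₂ (e , p∣g) = ⊥-elim (invertible⇒∤ e a (invertible e) (ℕ.∣-trans p∣g (ℕ.gcd[m,n]∣n 6 ℤ.∣ a ∣)))

gcd≡1⇒invertible : ∀ a → gcd (+ 6) a ≡ + 1 → ∀ e → InvertibleModulo e a
gcd≡1⇒invertible a gcd≡1 e with ModuloPrime.unit⊎zero e a
... | inj₁ invertible = invertible
... | inj₂ a≈0        = ⊥-elim (prime∤1 e (≡.subst (prime e ℕ.∣_) (ℤₚ.+-injective gcd≡1) (ℕ.gcd-greatest (prime∣6 e) (≈0⇒∣ e a a≈0))))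

theorem5p2 : (O : Order) (n : ℕ) → 2 ≤ n →
    ((∀ (M : Mat O n) → IsSumOfSixthPowers O M) ⇔ (gcd (+ 6) (disc O) ≡ + 1))
theorem5p2 O (suc (suc n)) (s≤s (s≤s z≤n)) = mk⇔ forward backward
  where
  open OverOrder O
  forward : (∀ M → IsSumOfSixthPowers O M) → gcd (+ 6) (disc O) ≡ + 1
  forward all = gcd≡1 (disc O) (λ e → Reduction.sums⇒unit e (λ M → to (all M)))
  backward : gcd (+ 6) (disc O) ≡ + 1 → ∀ M → IsSumOfSixthPowers O M
  backward gcd≡1 M = from (S.all-IsSum (S.corner (roots two) (roots three)) M)
    where
    roots : ∀ e x → ∃[ y ] ∃[ w ] x 𝒪.≈ (Frobenius._^_ 𝒪 y e 𝒪.+ power 𝒪._+_ e w)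
    roots e = let d , unit = gcd≡1⇒invertible (disc O) gcd≡1 e in Reduction.unit⇒roots e d unit
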